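{- There exist an effective programming system (eps) $\psi$ and a computably enumerable equivalence relation (ceer) $R\subseteq\mathrm{Equiv}(\psi)$ satisfying both (a) and (b) below. (a) For each translation function $t$ into $\psi$, $R$ strongly ties $t$ into $\psi$. (b) $\mathrm{Equiv}(\psi)$ is not computably enumerable.
   Context: $\mathbb{N}=\{0,1,2,\dots\}$. Partial functions map $\mathbb{N}$ to $\mathbb{N}$ unless stated otherwise; equality of partial functions means same domain and same values. An effective programming system (eps) is a partial computable function $\psi:(p,x)\mapsto\psi_p(x)$ from $\mathbb{N}^2$ to $\mathbb{N}$ such that for each partial computable function $\zeta$ from $\mathbb{N}$ to $\mathbb{N}$ there exists $p$ with $\psi_p=\zeta$. Here $\psi_p$ denotes the partial function $x\mapsto\psi_p(x)$. For epses $\theta$ and $\psi$, $\theta\le\psi$ iff there exists a (total) computable function $t:\mathbb{N}\to\mathbb{N}$ such that $\theta_p=\psi_{t(p)}$ for each $p$; such a $t$ is said to witness $\theta\le\psi$. A function $t:\mathbb{N}\to\mathbb{N}$ is a translation function into an eps $\psi$ iff there exists an eps $\theta$ such that $t$ witnesses $\theta\le\psi$ (equivalently, $t$ is computable and $(p,x)\mapsto\psi_{t(p)}(x)$ is an eps). The program equivalence relation of an eps $\psi$ is $\mathrm{Equiv}(\psi)=\{(p,q)\in\mathbb{N}^2 : \psi_p=\psi_q\}$. A ceer is an equivalence relation on $\mathbb{N}$ that is computably enumerable as a set of pairs. Let $\psi$ be an eps, $t$ a translation function into $\psi$, and $R$ an equivalence relation on $\mathbb{N}$. $R$ strongly ties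 $t$ into $\psi$ iff (i) $R\subseteq\mathrm{Equiv}(\psi)$ and (ii) the range of $t$ intersects each of $R$'s equivalence classes. -}

module Defs where

open import Level using (0ℓ)
open import Data.Fin using (Fin)
open import Data.Nat using (ℕ; zero; suc; _<_)
open import Data.Nat.Properties using (<-cmp)
open import Data.Product using (Σ-syntax; ∃; ∃-syntax; _×_; _,_)
open import Data.Unit using (⊤)
open import Data.Vec using (Vec; []; _∷_; lookup)
open import Function.Bundles using (_⇔_)
open import Relation.Binary using (Rel; IsEquivalence; _⇒_; tri<; tri≈; tri>)
open import Relation.Binary.PropositionalEquality
  using (_≡_; refl; sym; trans; cong₂)
open import Relation.Unary using (Pred; _∈_; _≬_)

-- A partial function is its graph, so that being undefined at an argument
-- need not be decidable.
record PartialFn (n : ℕ) : Set₁ where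
  field
    graph      : Vec ℕ n → ℕ → Set
    functional : ∀ xs {y z} → graph xs y → graph xs z → y ≡ z

open PartialFn public

infix 4 _≈_

_≈_ : ∀ {n} → PartialFn n → PartialFn n → Set
f ≈ g = ∀ xs y → graph f xs y ⇔ graph g xs y

dom : ∀ {n} → PartialFn n → Pred (Vec ℕ n) 0ℓ
dom f xs = ∃ (graph f xs)

-- Kleene's μ-recursive functions.
data Code : ℕ → Set where
  zer  : ∀ {n} → Code n
  succ : Code 1
  proj : ∀ {n} → Fin n → Code n
  comp : ∀ {m n} → Code m → Vec (Code n) m → Code n
  prec : ∀ {n} → Code n → Code (suc (suc n)) → Code (suc n)
  mu   : ∀ {n} → Code (suc n) → Code n

infix 4 _[_]⇓_ _[_]⇓*_

mutual
  _[_]⇓_ : ∀ {n} → Code n → Vec ℕ n → ℕ → Set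
  zer      [ xs ]⇓ y         = y ≡ 0
  succ     [ x ∷ [] ]⇓ y     = y ≡ suc x
  proj i   [ xs ]⇓ y         = y ≡ lookup xs i
  comp f gs [ xs ]⇓ y        = ∃[ zs ] (gs [ xs ]⇓* zs × f [ zs ]⇓ y)
  prec f g [ zero ∷ xs ]⇓ y  = f [ xs ]⇓ y
  prec f g [ suc k ∷ xs ]⇓ y =
    ∃[ r ] (prec f g [ k ∷ xs ]⇓ r × g [ k ∷ r ∷ xs ]⇓ y)
  mu f     [ xs ]⇓ y         =
    f [ y ∷ xs ]⇓ 0 × (∀ z → z < y → ∃[ v ] f [ z ∷ xs ]⇓ suc v)

  _[_]⇓*_ : ∀ {m n} → Vec (Code n) m → Vec ℕ n → Vec ℕ m → Set
  []       [ xs ]⇓* []       = ⊤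
  (g ∷ gs) [ xs ]⇓* (z ∷ zs) = g [ xs ]⇓ z × gs [ xs ]⇓* zs

mutual
  ⇓-functional : ∀ {n} (c : Code n) xs {y z} →
                 c [ xs ]⇓ y → c [ xs ]⇓ z → y ≡ z
  ⇓-functional zer        xs p q = trans p (sym q)
  ⇓-functional succ (x ∷ []) p q = trans p (sym q)
  ⇓-functional (proj i)   xs p q = trans p (sym q)
  ⇓-functional (comp f gs) xs (us , p , p′) (vs , q , q′)
    with refl ← ⇓*-functional gs xs us vs p q = ⇓-functional f us p′ q′
  ⇓-functional (prec f g) (zero ∷ xs) p q = ⇓-functional f xs p q
  ⇓-functional (prec f g) (suc k ∷ xs) (r , p , p′) (s , q , q′)
    with refl ← ⇓-functional (prec f g) (k ∷ xs) p q =
      ⇓-functional g (k ∷ r ∷ xs) p′ q′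
  ⇓-functional (mu f) xs {y} {z} (p , p<) (q , q<) with <-cmp y z
  ... | tri≈ _ y≡z _ = y≡z
  ... | tri< y<z _ _ with _ , r ← q< y y<z
                     with () ← ⇓-functional f (y ∷ xs) p r
  ... | tri> _ _ z<y with _ , r ← p< z z<y
                     with () ← ⇓-functional f (z ∷ xs) q r

  ⇓*-functional : ∀ {m n} (gs : Vec (Code n) m) xs us vs →
                  gs [ xs ]⇓* us → gs [ xs ]⇓* vs → us ≡ vs
  ⇓*-functional []       xs []       []       _        _        = refl
  ⇓*-functional (g ∷ gs) xs (u ∷ us) (v ∷ vs) (p , ps) (q , qs) =
    cong₂ _∷_ (⇓-functional g xs p q) (⇓*-functional gs xs us vs ps qs)

⟦_⟧ : ∀ {n} → Code n → PartialFn n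
⟦ c ⟧ = record { graph = c [_]⇓_ ; functional = ⇓-functional c }

PartialComputable : ∀ {n} → PartialFn n → Set
PartialComputable f = ∃[ c ] f ≈ ⟦ c ⟧

Computable : (ℕ → ℕ) → Set
Computable t = ∃[ c ] (∀ x → c [ x ∷ [] ]⇓ t x)

CE : Rel ℕ 0ℓ → Set₁
CE A = Σ[ f ∈ PartialFn 2 ]
         (PartialComputable f × (∀ p q → A p q ⇔ (p ∷ q ∷ []) ∈ dom f))

infixl 8 _at_

_at_ : PartialFn 2 → ℕ → PartialFn 1
graph      (ψ at p) xs = graph ψ (p ∷ xs)
functional (ψ at p) xs = functional ψ (p ∷ xs)

-- Read constructively, `complete` would yield a computable choice of p from a
-- code for ζ, making every eps acceptable; results on non-acceptable epses
-- therefore assume excluded middle.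
record Eps : Set₁ where
  field
    fn         : PartialFn 2
    computable : PartialComputable fn
    complete   : ∀ (ζ : PartialFn 1) → PartialComputable ζ →
                 ∃[ p ] fn at p ≈ ζ

open Eps public

prog : Eps → ℕ → PartialFn 1
prog ψ p = fn ψ at p

record Witnesses (t : ℕ → ℕ) (θ ψ : Eps) : Set where
  field
    computable : Computable t
    translates : ∀ p → prog θ p ≈ prog ψ (t p)

IsTranslationInto : (ℕ → ℕ) → Eps → Set₁
IsTranslationInto t ψ = Σ[ θ ∈ Eps ] Witnesses t θ ψ

Equiv : Eps → Rel ℕ 0ℓ
Equiv ψ p q = prog ψ p ≈ prog ψ q

record IsCeer (R : Rel ℕ 0ℓ) : Set₁ where
  field
    isEquivalence : IsEquivalence R
    enumerable    : CE R

range : (ℕ → ℕ) → Pred ℕ 0ℓ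
range t y = ∃[ x ] t x ≡ y

-- The equivalence class of p is the predicate R p.
record StronglyTies (R : Rel ℕ 0ℓ) (t : ℕ → ℕ) (ψ : Eps) : Set where
  field
    sound : R ⇒ Equiv ψ
    meets : ∀ p → range t ≬ R p

{-# OPTIONS --safe #-}
module Submission where

open import Defs
open import Level using (0ℓ)
open import Axiom.ExcludedMiddle using (ExcludedMiddle)
open import Data.Empty using (⊥)
open import Data.Bool using (if_then_else_)
open import Data.Fin using (Fin; zero; suc; toℕ)
open import Data.List using (List; []; _∷_; _++_; length)
open import Data.List.Membership.Propositional using (_∈_)
open import Data.List.Membership.Propositional.Properties using (∈-++⁺ˡ; ∈-++⁺ʳ)
open import Data.List.Relation.Unary.Any using (here; there)
open import Data.Nat
open import Data.Nat.Properties
open import Data.Product using (Σ-syntax; ∃-syntax; _×_; _,_; proj₁; proj₂)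
open import Data.Sum using (_⊎_; inj₁; inj₂)
open import Data.Unit using (tt)
open import Data.Vec using (Vec; []; _∷_; lookup; tabulate; map)
open import Data.Vec.Properties using (tabulate∘lookup)
open import Function using (id)
open import Function.Bundles using (_⇔_; mk⇔; Equivalence)
open import Relation.Binary using (Rel; _⇒_; tri<; tri≈; tri>)
open import Relation.Binary.PropositionalEquality
open import Relation.Nullary using (¬_; Dec; yes; no; does; contradiction)
open import Relation.Nullary.Decidable using (_×-dec_; _⊎-dec_; _→-dec_; ¬?; map′)

-- Let η₀, η₁, … be all unary partial computable functions and E(i,u) the finite
-- part of η_i found within u steps. An index p = (i,u,s) starts out as a program
-- for E(i,u). The size of a finite function is decoded as a pair (j,e). Function
-- j visits those of its own finite parts whose size has first component j, and
-- at certain stages t all indices (i,u,s) with s ≤ t and E(i,u) visited by j are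
-- handed over to j, i.e. they compute from then on the union of all parts
-- visited by j, which is η_j if η_j is infinite. This happens at every stage as
-- long as no larger part has been visited, and once when η_e takes an index of
-- this finite function as a value. Tie together the indices handed over to the
-- same j, and the unaffected indices of the same finite function.
-- A finite function then has one class only, so every translation η_e meets it.
-- If η_j is infinite, then η_e takes an index of its part of size (j,e) as a
-- value, and this index or one like it is handed over to j. Thus η_e meets every
-- class, although all infinite η_j with the same graph keep their own class,
-- which by a diagonal argument makes program equivalence not enumerable.

-- Computable functions and decidable relations with their codes

ind : {P : Set} → Dec P → ℕ
ind d = if does d then 1 else 0

ind≡0⇒¬ : {P : Set} (d : Dec P) → ind d ≡ 0 → ¬ P
ind≡0⇒¬ (no ¬p) _ = ¬p

¬⇒ind≡0 : {P : Set} (d : Dec P) → ¬ P → ind d ≡ 0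
¬⇒ind≡0 (yes p) ¬p = contradiction p ¬p
¬⇒ind≡0 (no _)  _  = refl

ind≡1 : {P : Set} (d : Dec P) → P → ind d ≡ 1
ind≡1 (yes _) _ = refl
ind≡1 (no ¬p) p = contradiction p ¬p

cnt : {P : ℕ → Set} → (∀ i → Dec (P i)) → ℕ → ℕ
cnt P? zero    = 0
cnt P? (suc k) = cnt P? k + ind (P? k)

cnt≡0⇒none : {P : ℕ → Set} (P? : ∀ i → Dec (P i)) → ∀ k → cnt P? k ≡ 0 →
             ∀ i → i < k → ¬ P i
cnt≡0⇒none P? (suc k) eq i i<1+k with m≤n⇒m<n∨m≡n (≤-pred i<1+k)
... | inj₁ i<k  = cnt≡0⇒none P? k (m+n≡0⇒m≡0 _ eq) i i<k
... | inj₂ refl = ind≡0⇒¬ (P? k) (m+n≡0⇒n≡0 (cnt P? k) eq)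

none⇒cnt≡0 : {P : ℕ → Set} (P? : ∀ i → Dec (P i)) → ∀ k →
             (∀ i → i < k → ¬ P i) → cnt P? k ≡ 0
none⇒cnt≡0 P? zero    _    = refl
none⇒cnt≡0 P? (suc k) none = cong₂ _+_
  (none⇒cnt≡0 P? k λ i i<k → none i (m<n⇒m<1+n i<k))
  (¬⇒ind≡0 (P? k) (none k ≤-refl))

least : {P : ℕ → Set} → (∀ i → Dec (P i)) → ∀ s → P s →
        ∃[ m ] P m × (∀ z → z < m → ¬ P z)
least {P} P? s p = search 0 (λ _ ()) s refl
  where
  search : ∀ k → (∀ z → z < k → ¬ P z) → ∀ n → k + n ≡ s →
            ∃[ m ] P m × (∀ z → z < m → ¬ P z)
  search k below n eq with P? k
  ... | yes pk = k , pk , below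
  search k below zero eq | no ¬pk =
    contradiction (subst P (trans (sym eq) (+-identityʳ k)) p) ¬pk
  search k below (suc n) eq | no ¬pk =
    search (suc k) below′ n (trans (sym (+-suc k n)) eq)
    where
    below′ : ∀ z → z < suc k → ¬ P z
    below′ z z<1+k with m≤n⇒m<n∨m≡n (≤-pred z<1+k)
    ... | inj₁ z<k  = below z z<k
    ... | inj₂ refl = ¬pk

Computes : ∀ {n} → Code n → (Vec ℕ n → ℕ) → Set
Computes c f = ∀ xs → c [ xs ]⇓ f xs

record Fun (n : ℕ) : Set where
  field
    fun      : Vec ℕ n → ℕ
    code     : Code n
    computes : Computes code fun

-- `Holds` is a proposition of its own rather than an equation about the characteristic function, so
-- that the relations assembled below unfold by computation to the ones they stand for.
record DecRel (n : ℕ) : Set₁ where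
  field
    Holds    : Vec ℕ n → Set
    holds?   : ∀ xs → Dec (Holds xs)
    code     : Code n
    computes : Computes code (λ xs → ind (holds? xs))

open Fun public using (fun)
open DecRel public using (Holds; holds?)

module F = Fun
module R = DecRel

projs : ∀ {m n} → (Fin m → Fin n) → Vec (Code n) m
projs ρ = tabulate (λ i → proj (ρ i))

projs-⇓ : ∀ {m n} (ρ : Fin m → Fin n) xs →
          projs ρ [ xs ]⇓* tabulate (λ i → lookup xs (ρ i))
projs-⇓ {zero}  ρ xs = tt
projs-⇓ {suc m} ρ xs = refl , projs-⇓ (λ i → ρ (suc i)) xs

projs-id-⇓ : ∀ {n} (xs : Vec ℕ n) → projs id [ xs ]⇓* xs
projs-id-⇓ xs = subst (projs id [ xs ]⇓*_) (tabulate∘lookup xs) (projs-⇓ id xs)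

funs : ∀ {m n} → Vec (Fun n) m → Vec ℕ n → Vec ℕ m
funs []       xs = []
funs (f ∷ fs) xs = fun f xs ∷ funs fs xs

funs-⇓ : ∀ {m n} (fs : Vec (Fun n) m) xs → map F.code fs [ xs ]⇓* funs fs xs
funs-⇓ []       xs = tt
funs-⇓ (f ∷ fs) xs = F.computes f xs , funs-⇓ fs xs

infixl 9 _⟨_⟩ᶠ _⟨_⟩

_⟨_⟩ᶠ : ∀ {m n} → Fun m → Vec (Fun n) m → Fun n
f ⟨ gs ⟩ᶠ = record
  { fun      = λ xs → fun f (funs gs xs)
  ; code     = comp (F.code f) (map F.code gs)
  ; computes = λ xs → funs gs xs , funs-⇓ gs xs , F.computes f (funs gs xs)
  }

_⟨_⟩ : ∀ {m n} → DecRel m → Vec (Fun n) m → DecRel n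
A ⟨ gs ⟩ = record
  { Holds    = λ xs → Holds A (funs gs xs)
  ; holds?   = λ xs → holds? A (funs gs xs)
  ; code     = comp (R.code A) (map F.code gs)
  ; computes = λ xs → funs gs xs , funs-⇓ gs xs , R.computes A (funs gs xs)
  }

var : ∀ {n} → Fin n → Fun n
var i = record
  { fun = λ xs → lookup xs i ; code = proj i ; computes = λ _ → refl }

x0 : ∀ {n} → Fun (1 + n)
x0 = var zero
x1 : ∀ {n} → Fun (2 + n)
x1 = var (suc zero)
x2 : ∀ {n} → Fun (3 + n)
x2 = var (suc (suc zero))
x3 : ∀ {n} → Fun (4 + n)
x3 = var (suc (suc (suc zero)))
x4 : ∀ {n} → Fun (5 + n)
x4 = var (suc (suc (suc (suc zero))))
x5 : ∀ {n} → Fun (6 + n)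
x5 = var (suc (suc (suc (suc (suc zero)))))
x6 : ∀ {n} → Fun (7 + n)
x6 = var (suc (suc (suc (suc (suc (suc zero))))))
x7 : ∀ {n} → Fun (8 + n)
x7 = var (suc (suc (suc (suc (suc (suc (suc zero)))))))

sucᶠ : ∀ {n} → Fun n → Fun n
sucᶠ f = record
  { fun      = λ xs → suc (fun f xs)
  ; code     = comp succ (F.code f ∷ [])
  ; computes = λ xs → fun f xs ∷ [] , (F.computes f xs , tt) , refl
  }

lit : ∀ {n} → ℕ → Fun n
lit {n} k = record { fun = λ _ → k ; code = numeral k ; computes = ok k }
  where
  numeral : ℕ → Code n
  numeral zero    = zer
  numeral (suc k) = comp succ (numeral k ∷ [])
  ok : ∀ k → Computes (numeral k) (λ _ → k)
  ok zero    _  = refl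
  ok (suc k) xs = k ∷ [] , (ok k xs , tt) , refl

-- Arithmetic functions

uncurry₁ : (ℕ → ℕ) → Vec ℕ 1 → ℕ
uncurry₁ f (a ∷ []) = f a

uncurry₂ : (ℕ → ℕ → ℕ) → Vec ℕ 2 → ℕ
uncurry₂ f (a ∷ b ∷ []) = f a b

plus : Fun 2
plus = record { fun = uncurry₂ _+_ ; code = c ; computes = ok }
  where
  c = prec (proj zero) (comp succ (proj (suc zero) ∷ []))
  ok : Computes c (uncurry₂ _+_)
  ok (zero  ∷ y ∷ []) = refl
  ok (suc k ∷ y ∷ []) = k + y , ok (k ∷ y ∷ []) , k + y ∷ [] , (refl , tt) , refl

infixl 6 _+ᶠ_ _∸ᶠ_
infixl 7 _*ᶠ_

_+ᶠ_ : ∀ {n} → Fun n → Fun n → Fun n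
f +ᶠ g = plus ⟨ f ∷ g ∷ [] ⟩ᶠ

times : Fun 2
times = record { fun = uncurry₂ _*_ ; code = c ; computes = ok }
  where
  step : Fun 3
  step = x2 +ᶠ x1
  c = prec zer (F.code step)
  ok : Computes c (uncurry₂ _*_)
  ok (zero  ∷ y ∷ []) = refl
  ok (suc k ∷ y ∷ []) = k * y , ok (k ∷ y ∷ []) , F.computes step (k ∷ k * y ∷ y ∷ [])

_*ᶠ_ : ∀ {n} → Fun n → Fun n → Fun n
f *ᶠ g = times ⟨ f ∷ g ∷ [] ⟩ᶠ

predecessor : Fun 1
predecessor = record { fun = uncurry₁ pred ; code = c ; computes = ok }
  where
  c = prec zer (proj zero)
  ok : Computes c (uncurry₁ pred)
  ok (zero  ∷ []) = refl
  ok (suc k ∷ []) = pred k , ok (k ∷ []) , refl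

-- The subtrahend comes first because `prec` recurses on the first argument.
monus : Fun 2
monus = record { fun = uncurry₂ (λ b a → a ∸ b) ; code = c ; computes = ok }
  where
  step : Fun 3
  step = predecessor ⟨ x1 ∷ [] ⟩ᶠ
  c = prec (proj zero) (F.code step)
  ok : Computes c (uncurry₂ (λ b a → a ∸ b))
  ok (zero  ∷ a ∷ []) = refl
  ok (suc k ∷ a ∷ []) = a ∸ k , ok (k ∷ a ∷ []) ,
    subst (F.code step [ k ∷ a ∸ k ∷ a ∷ [] ]⇓_) (pred[m∸n]≡m∸[1+n] a k)
      (F.computes step (k ∷ a ∸ k ∷ a ∷ []))

_∸ᶠ_ : ∀ {n} → Fun n → Fun n → Fun n
f ∸ᶠ g = monus ⟨ g ∷ f ∷ [] ⟩ᶠ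

iszero : Fun 1
iszero = record { fun = uncurry₁ λ x → ind (x ≟ 0) ; code = c ; computes = ok }
  where
  c = prec (comp succ (zer ∷ [])) zer
  ok : Computes c (uncurry₁ λ x → ind (x ≟ 0))
  ok (zero  ∷ []) = 0 ∷ [] , (refl , tt) , refl
  ok (suc k ∷ []) = _ , ok (k ∷ []) , refl

-- Logical connectives and bounded quantifiers

χ : ∀ {n} → DecRel n → Fun n
χ A = record
  { fun      = λ xs → ind (holds? A xs)
  ; code     = R.code A
  ; computes = R.computes A
  }

module _ {n} (f : Fun n) (P : Vec ℕ n → Set) (P? : ∀ xs → Dec (P xs))
         (to   : ∀ xs → fun f xs ≡ 0 → P xs)
         (from : ∀ xs → P xs → fun f xs ≡ 0) where

  -- Comparisons, connectives and bounded quantifiers are all entered as zero sets of computable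
  -- functions; composing with `iszero` gives the characteristic function.
  rel : DecRel n
  rel = record
    { Holds    = P
    ; holds?   = P?
    ; code     = F.code (iszero ⟨ f ∷ [] ⟩ᶠ)
    ; computes = λ xs → subst (F.code (iszero ⟨ f ∷ [] ⟩ᶠ) [ xs ]⇓_)
                   (agree xs (fun f xs ≟ 0) (P? xs))
                   (F.computes (iszero ⟨ f ∷ [] ⟩ᶠ) xs)
    }
    where
    agree : ∀ xs (d : Dec (fun f xs ≡ 0)) (e : Dec (P xs)) → ind d ≡ ind e
    agree xs (yes f≡0) (yes _) = refl
    agree xs (no _)    (no _)  = refl
    agree xs (yes f≡0) (no ¬p) = contradiction (to xs f≡0) ¬p
    agree xs (no f≢0)  (yes p) = contradiction (from xs p) f≢0

infix  5 _≡ᴿ_ _≤ᴿ_ _<ᴿ_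
infix  4 ¬ᴿ_
infixr 3 _∧ᴿ_
infixr 2 _∨ᴿ_
infixr 1 _⇒ᴿ_

_≤ᴿ_ : ∀ {n} → Fun n → Fun n → DecRel n
f ≤ᴿ g = rel (f ∸ᶠ g) (λ xs → fun f xs ≤ fun g xs) (λ xs → fun f xs ≤? fun g xs)
  (λ _ → m∸n≡0⇒m≤n) (λ _ → m≤n⇒m∸n≡0)

_<ᴿ_ : ∀ {n} → Fun n → Fun n → DecRel n
f <ᴿ g = sucᶠ f ≤ᴿ g

_≡ᴿ_ : ∀ {n} → Fun n → Fun n → DecRel n
f ≡ᴿ g = rel ((f ∸ᶠ g) +ᶠ (g ∸ᶠ f)) (λ xs → fun f xs ≡ fun g xs)
  (λ xs → fun f xs ≟ fun g xs)
  (λ xs eq → ≤-antisym (m∸n≡0⇒m≤n (m+n≡0⇒m≡0 _ eq))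
                       (m∸n≡0⇒m≤n (m+n≡0⇒n≡0 (fun f xs ∸ fun g xs) eq)))
  (λ xs eq → cong₂ _+_ (m≤n⇒m∸n≡0 (≤-reflexive eq)) (m≤n⇒m∸n≡0 (≤-reflexive (sym eq))))

¬ᴿ_ : ∀ {n} → DecRel n → DecRel n
¬ᴿ A = rel (χ A) (λ xs → ¬ Holds A xs) (λ xs → ¬? (holds? A xs))
  (λ xs → ind≡0⇒¬ (holds? A xs)) (λ xs → ¬⇒ind≡0 (holds? A xs))

χ¬≡0⇒ : ∀ {n} (A : DecRel n) xs → fun (χ (¬ᴿ A)) xs ≡ 0 → Holds A xs
χ¬≡0⇒ A xs eq with holds? A xs
... | yes a = a

⇒χ¬≡0 : ∀ {n} (A : DecRel n) xs → Holds A xs → fun (χ (¬ᴿ A)) xs ≡ 0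
⇒χ¬≡0 A xs a = ¬⇒ind≡0 (holds? (¬ᴿ A) xs) λ ¬a → ¬a a

_∧ᴿ_ : ∀ {n} → DecRel n → DecRel n → DecRel n
A ∧ᴿ B = rel (χ (¬ᴿ A) +ᶠ χ (¬ᴿ B)) (λ xs → Holds A xs × Holds B xs)
  (λ xs → holds? A xs ×-dec holds? B xs)
  (λ xs eq → χ¬≡0⇒ A xs (m+n≡0⇒m≡0 _ eq) ,
             χ¬≡0⇒ B xs (m+n≡0⇒n≡0 (fun (χ (¬ᴿ A)) xs) eq))
  (λ xs (a , b) → cong₂ _+_ (⇒χ¬≡0 A xs a) (⇒χ¬≡0 B xs b))

_∨ᴿ_ : ∀ {n} → DecRel n → DecRel n → DecRel n
A ∨ᴿ B = rel (χ (¬ᴿ A) *ᶠ χ (¬ᴿ B)) (λ xs → Holds A xs ⊎ Holds B xs)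
  (λ xs → holds? A xs ⊎-dec holds? B xs) to from
  where
  to : ∀ xs → fun (χ (¬ᴿ A)) xs * fun (χ (¬ᴿ B)) xs ≡ 0 → Holds A xs ⊎ Holds B xs
  to xs eq with m*n≡0⇒m≡0∨n≡0 (fun (χ (¬ᴿ A)) xs) eq
  ... | inj₁ a = inj₁ (χ¬≡0⇒ A xs a)
  ... | inj₂ b = inj₂ (χ¬≡0⇒ B xs b)
  from : ∀ xs → Holds A xs ⊎ Holds B xs → fun (χ (¬ᴿ A)) xs * fun (χ (¬ᴿ B)) xs ≡ 0
  from xs (inj₁ a) = cong (_* fun (χ (¬ᴿ B)) xs) (⇒χ¬≡0 A xs a)
  from xs (inj₂ b) = trans (cong (fun (χ (¬ᴿ A)) xs *_) (⇒χ¬≡0 B xs b))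
                           (*-zeroʳ (fun (χ (¬ᴿ A)) xs))

_⇒ᴿ_ : ∀ {n} → DecRel n → DecRel n → DecRel n
A ⇒ᴿ B = rel (χ A *ᶠ χ (¬ᴿ B)) (λ xs → Holds A xs → Holds B xs)
  (λ xs → holds? A xs →-dec holds? B xs) to from
  where
  to : ∀ xs → fun (χ A) xs * fun (χ (¬ᴿ B)) xs ≡ 0 → Holds A xs → Holds B xs
  to xs eq a with m*n≡0⇒m≡0∨n≡0 (fun (χ A) xs) eq
  ... | inj₁ ¬a = contradiction a (ind≡0⇒¬ (holds? A xs) ¬a)
  ... | inj₂ b  = χ¬≡0⇒ B xs b
  from : ∀ xs → (Holds A xs → Holds B xs) → fun (χ A) xs * fun (χ (¬ᴿ B)) xs ≡ 0
  from xs a⇒b = go (holds? A xs)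
    where
    go : (d : Dec (Holds A xs)) → ind d * fun (χ (¬ᴿ B)) xs ≡ 0
    go (yes a) = trans (+-identityʳ _) (⇒χ¬≡0 B xs (a⇒b a))
    go (no _)  = refl

-- The value is displayed as `f` instead of the arithmetic term `g`, which keeps opaque functions
-- folded in later relations.
named₁ : (f : ℕ → ℕ) (g : Fun 1) → (∀ a → fun g (a ∷ []) ≡ f a) → Fun 1
named₁ f g eq = record
  { fun      = uncurry₁ f
  ; code     = F.code g
  ; computes = λ { (a ∷ []) → subst (F.code g [ a ∷ [] ]⇓_) (eq a) (F.computes g (a ∷ [])) }
  }

named₂ : (f : ℕ → ℕ → ℕ) (g : Fun 2) → (∀ a b → fun g (a ∷ b ∷ []) ≡ f a b) → Fun 2
named₂ f g eq = record
  { fun      = uncurry₂ f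
  ; code     = F.code g
  ; computes = λ { (a ∷ b ∷ []) →
      subst (F.code g [ a ∷ b ∷ [] ]⇓_) (eq a b) (F.computes g (a ∷ b ∷ [])) }
  }

count : ∀ {n} → Fun n → DecRel (suc n) → Fun n
count {n} t A = record
  { fun      = λ xs → cnt (λ i → holds? A (i ∷ xs)) (fun t xs)
  ; code     = comp loop (F.code t ∷ projs id)
  ; computes = λ xs → fun t xs ∷ xs , (F.computes t xs , projs-id-⇓ xs) ,
                      loop-ok (fun t xs) xs
  }
  where
  added : Code (2 + n)
  added = comp (R.code A) (proj zero ∷ projs (λ i → suc (suc i)))

  loop : Code (suc n)
  loop = prec zer (comp (F.code plus) (proj (suc zero) ∷ added ∷ []))

  loop-ok : ∀ k xs → loop [ k ∷ xs ]⇓ cnt (λ i → holds? A (i ∷ xs)) k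
  loop-ok zero    xs = refl
  loop-ok (suc k) xs = r , loop-ok k xs ,
    r ∷ ind (holds? A (k ∷ xs)) ∷ [] ,
    (refl , (k ∷ xs , (refl , rest) , R.computes A (k ∷ xs)) , tt) ,
    F.computes plus (r ∷ ind (holds? A (k ∷ xs)) ∷ [])
    where
    r = cnt (λ i → holds? A (i ∷ xs)) k
    rest : projs (λ i → suc (suc i)) [ k ∷ r ∷ xs ]⇓* xs
    rest = subst (projs (λ i → suc (suc i)) [ k ∷ r ∷ xs ]⇓*_) (tabulate∘lookup xs)
             (projs-⇓ (λ i → suc (suc i)) (k ∷ r ∷ xs))

all< : ∀ {n} → Fun n → DecRel (suc n) → DecRel n
all< t A = rel (count t (¬ᴿ A)) (λ xs → ∀ i → i < fun t xs → Holds A (i ∷ xs))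
  (λ xs → map′ (λ f i → f {i}) (λ f {i} → f i)
            (allUpTo? (λ i → holds? A (i ∷ xs)) (fun t xs)))
  (λ xs eq i i<t → χ¬≡0⇒ A (i ∷ xs)
     (¬⇒ind≡0 (holds? (¬ᴿ A) (i ∷ xs))
       (cnt≡0⇒none (λ i → holds? (¬ᴿ A) (i ∷ xs)) (fun t xs) eq i i<t)))
  (λ xs f → none⇒cnt≡0 (λ i → holds? (¬ᴿ A) (i ∷ xs)) (fun t xs)
     λ i i<t ¬a → ¬a (f i i<t))

ex< : ∀ {n} → Fun n → DecRel (suc n) → DecRel n
ex< t A = rel (χ (all< t (¬ᴿ A))) (λ xs → ∃[ i ] (i < fun t xs × Holds A (i ∷ xs)))
  E? to
  (λ xs (i , i<t , a) → ¬⇒ind≡0 (holds? (all< t (¬ᴿ A)) xs) λ none → none i i<t a)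
  where
  E? : ∀ xs → Dec (∃[ i ] (i < fun t xs × Holds A (i ∷ xs)))
  E? xs = anyUpTo? (λ i → holds? A (i ∷ xs)) (fun t xs)
  to : ∀ xs → fun (χ (all< t (¬ᴿ A))) xs ≡ 0 → ∃[ i ] (i < fun t xs × Holds A (i ∷ xs))
  to xs eq with E? xs
  ... | yes e = e
  ... | no ¬e = contradiction (λ i i<t a → ¬e (i , i<t , a))
                  (ind≡0⇒¬ (holds? (all< t (¬ᴿ A)) xs) eq)

IfZero : ℕ → Set → Set → Set
IfZero zero    A B = A
IfZero (suc _) A B = B

ifzero : ∀ {n} → Fun n → DecRel n → DecRel n → DecRel n
ifzero t A B = rel (χ (¬ᴿ C))
  (λ xs → IfZero (fun t xs) (Holds A xs) (Holds B xs))
  (λ xs → dec (fun t xs) (holds? A xs) (holds? B xs))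
  (λ xs eq → to (fun t xs) (χ¬≡0⇒ C xs eq))
  (λ xs h → ⇒χ¬≡0 C xs (from (fun t xs) h))
  where
  C = (t ≡ᴿ lit 0 ∧ᴿ A) ∨ᴿ (lit 1 ≤ᴿ t ∧ᴿ B)
  dec : ∀ k {A B : Set} → Dec A → Dec B → Dec (IfZero k A B)
  dec zero    a b = a
  dec (suc _) a b = b
  to : ∀ k {A B : Set} → (k ≡ 0 × A) ⊎ (1 ≤ k × B) → IfZero k A B
  to zero    (inj₁ (_ , a)) = a
  to zero    (inj₂ (() , _))
  to (suc _) (inj₂ (_ , b)) = b
  from : ∀ k {A B : Set} → IfZero k A B → (k ≡ 0 × A) ⊎ (1 ≤ k × B)
  from zero    a = inj₁ (refl , a)
  from (suc _) b = inj₂ (s≤s z≤n , b)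

-- Unbounded search finds the least witness, from which `out` reads off the value.
Σ₁⇒PartialComputable :
  ∀ {n} (f : PartialFn n) (A : DecRel (suc n)) (out : Fun 1) →
  (∀ xs y → graph f xs y ⇔ (∃[ s ] (Holds A (s ∷ xs) × fun out (s ∷ []) ≡ y))) →
  PartialComputable f
Σ₁⇒PartialComputable f A out spec =
  comp (F.code out) (mu (R.code (¬ᴿ A)) ∷ []) , λ xs y → mk⇔ (to xs y) (from xs y)
  where
  module S xs y = Equivalence (spec xs y)
  to : ∀ xs y → graph f xs y → comp (F.code out) (mu (R.code (¬ᴿ A)) ∷ []) [ xs ]⇓ y
  to xs y fy with s , a , _ ← S.to xs y fy
             with m , am , below ← least (λ s → holds? A (s ∷ xs)) s a =
    m ∷ [] ,
    (( subst (R.code (¬ᴿ A) [ m ∷ xs ]⇓_) (⇒χ¬≡0 A (m ∷ xs) am)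
         (R.computes (¬ᴿ A) (m ∷ xs))
     , λ z z<m → 0 , subst (R.code (¬ᴿ A) [ z ∷ xs ]⇓_)
         (ind≡1 (holds? (¬ᴿ A) (z ∷ xs)) (below z z<m))
         (R.computes (¬ᴿ A) (z ∷ xs)))
    , tt) ,
    -- The least witness may differ from `s`, but as `f` is single-valued both yield the same value.
    subst (F.code out [ m ∷ [] ]⇓_)
      (functional f xs (S.from xs _ (m , am , refl)) fy) (F.computes out (m ∷ []))
  from : ∀ xs y → comp (F.code out) (mu (R.code (¬ᴿ A)) ∷ []) [ xs ]⇓ y → graph f xs y
  from xs y (m ∷ [] , ((z , _) , _) , o) = S.from xs y
    ( m
    , χ¬≡0⇒ A (m ∷ xs)
        (⇓-functional (R.code (¬ᴿ A)) (m ∷ xs) (R.computes (¬ᴿ A) (m ∷ xs)) z)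
    , ⇓-functional (F.code out) (m ∷ []) (F.computes out (m ∷ [])) o)

-- Pairing and a universal relation

cnt-below : ∀ m n → m ≤ n → {P : ℕ → Set} (P? : ∀ i → Dec (P i)) →
            (∀ i → i < m → P i) → (∀ i → P i → i < m) → cnt P? n ≡ m
cnt-below zero zero m≤n P? f g = refl
cnt-below m (suc n) m≤n P? f g with m≤n⇒m<n∨m≡n m≤n
... | inj₁ m<1+n = trans
  (cong₂ _+_ (cnt-below m n (≤-pred m<1+n) P? f g)
             (¬⇒ind≡0 (P? n) λ pn → <⇒≱ (g n pn) (≤-pred m<1+n)))
  (+-identityʳ m)
... | inj₂ refl = trans
  (cong₂ _+_ (all-below n λ i i<n → f i (m<n⇒m<1+n i<n)) (ind≡1 (P? n) (f n ≤-refl)))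
  (+-comm n 1)
  where
  all-below : ∀ k → (∀ i → i < k → _) → cnt P? k ≡ k
  all-below zero    h = refl
  all-below (suc k) h = trans
    (cong₂ _+_ (all-below k λ i i<k → h i (m<n⇒m<1+n i<k)) (ind≡1 (P? k) (h k ≤-refl)))
    (+-comm k 1)

n≤n*n : ∀ n → n ≤ n * n
n≤n*n zero    = z≤n
n≤n*n (suc n) = m≤m*n (suc n) (suc n)

-- The integer square root: the k with (k + 1)² ≤ n form an initial segment, whose length is
-- counted.
sqrt : ℕ → ℕ
sqrt n = cnt (λ k → suc k * suc k ≤? n) n

sqrt-unique : ∀ r a → a ≤ r → sqrt (r * r + a) ≡ r
sqrt-unique r a a≤r = cnt-below r n r≤n (λ k → suc k * suc k ≤? n)
  (λ k k<r → ≤-trans (*-mono-≤ k<r k<r) (m≤m+n (r * r) a))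
  (λ k le → ≰⇒> λ r≤k → <-irrefl refl (<-≤-trans (n<square k r≤k) le))
  where
  n : ℕ
  n = r * r + a
  r≤n : r ≤ n
  r≤n = ≤-trans (n≤n*n r) (m≤m+n (r * r) a)
  n<square : ∀ k → r ≤ k → n < suc k * suc k
  n<square k r≤k = s≤s (begin
    r * r + a      ≤⟨ +-mono-≤ (*-mono-≤ r≤k (m≤n⇒m≤1+n r≤k)) (≤-trans a≤r r≤k) ⟩
    k * suc k + k  ≡⟨ +-comm (k * suc k) k ⟩
    k + k * suc k  ∎)
    where open ≤-Reasoning

opaque
  -- Since a ≤ a + b, this number lies below the square of a + b + 1, so its integer square root
  -- gives back a + b. The pairing is not onto.
  pr : ℕ → ℕ → ℕ
  pr a b = (a + b) * (a + b) + a

  π₁ π₂ : ℕ → ℕ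
  π₁ n = n ∸ sqrt n * sqrt n
  π₂ n = sqrt n ∸ π₁ n

  π₁-pr : ∀ a b → π₁ (pr a b) ≡ a
  π₁-pr a b = trans (cong (λ r → pr a b ∸ r * r) (sqrt-unique (a + b) a (m≤m+n a b)))
                    (m+n∸m≡n ((a + b) * (a + b)) a)

  π₂-pr : ∀ a b → π₂ (pr a b) ≡ b
  π₂-pr a b = trans (cong₂ _∸_ (sqrt-unique (a + b) a (m≤m+n a b)) (π₁-pr a b))
                    (m+n∸m≡n a b)

  π₁≤ : ∀ n → π₁ n ≤ n
  π₁≤ n = m∸n≤m n (sqrt n * sqrt n)

  ≤pr : ∀ a b → b ≤ pr a b
  ≤pr a b = ≤-trans (m≤n+m b a) (≤-trans (n≤n*n (a + b)) (m≤m+n ((a + b) * (a + b)) a))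

sqrtᶠ : Fun 1
sqrtᶠ = named₁ sqrt (count x0 (sucᶠ x0 *ᶠ sucᶠ x0 ≤ᴿ x1)) λ _ → refl

pr-term : Fun 2
pr-term = (x0 +ᶠ x1) *ᶠ (x0 +ᶠ x1) +ᶠ x0

π₁-term π₂-term : Fun 1
π₁-term = x0 ∸ᶠ (sqrtᶠ ⟨ x0 ∷ [] ⟩ᶠ *ᶠ sqrtᶠ ⟨ x0 ∷ [] ⟩ᶠ)
π₂-term = sqrtᶠ ⟨ x0 ∷ [] ⟩ᶠ ∸ᶠ π₁-term

opaque
  unfolding pr

  pr-spec : ∀ a b → fun pr-term (a ∷ b ∷ []) ≡ pr a b
  pr-spec a b = refl

  π₁-spec : ∀ n → fun π₁-term (n ∷ []) ≡ π₁ n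
  π₁-spec n = refl

  π₂-spec : ∀ n → fun π₂-term (n ∷ []) ≡ π₂ n
  π₂-spec n = refl

prᶠ : ∀ {n} → Fun n → Fun n → Fun n
prᶠ f g = named₂ pr pr-term pr-spec ⟨ f ∷ g ∷ [] ⟩ᶠ

π₁ᶠ π₂ᶠ : ∀ {n} → Fun n → Fun n
π₁ᶠ f = named₁ π₁ π₁-term π₁-spec ⟨ f ∷ [] ⟩ᶠ
π₂ᶠ f = named₁ π₂ π₂-term π₂-spec ⟨ f ∷ [] ⟩ᶠ

drop : ℕ → ℕ → ℕ
drop zero    d = d
drop (suc i) d = π₂ (drop i d)

drop-suc : ∀ i d → drop (suc i) d ≡ drop i (π₂ d)
drop-suc zero    d = refl
drop-suc (suc i) d = cong π₂ (drop-suc i d)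

nth : ℕ → ℕ → ℕ
nth d i = π₁ (drop i d)

nth-zero : ∀ a d → nth (pr a d) 0 ≡ a
nth-zero = π₁-pr

nth-suc : ∀ a d i → nth (pr a d) (suc i) ≡ nth d i
nth-suc a d i = cong π₁ (trans (drop-suc i (pr a d)) (cong (drop i) (π₂-pr a d)))

nthᶠ : ∀ {n} → Fun n → Fun n → Fun n
nthᶠ d i = π₁ᶠ (dropᶠ ⟨ i ∷ d ∷ [] ⟩ᶠ)
  where
  step : Fun 3
  step = π₂ᶠ x1
  ok : Computes (prec (proj zero) (F.code step)) (uncurry₂ drop)
  ok (zero  ∷ d ∷ []) = refl
  ok (suc i ∷ d ∷ []) = drop i d , ok (i ∷ d ∷ []) , F.computes step (i ∷ drop i d ∷ d ∷ [])
  dropᶠ : Fun 2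
  dropᶠ = record { fun = uncurry₂ drop ; code = prec (proj zero) (F.code step) ; computes = ok }

-- Numbers of codes and one-step evaluation

⌜_⌝ᵛ : ∀ {n} → Vec ℕ n → ℕ
⌜ [] ⌝ᵛ     = 0
⌜ x ∷ xs ⌝ᵛ = pr x ⌜ xs ⌝ᵛ

nth-⌜⌝ᵛ : ∀ {n} (xs : Vec ℕ n) i → nth ⌜ xs ⌝ᵛ (toℕ i) ≡ lookup xs i
nth-⌜⌝ᵛ (x ∷ xs) zero    = nth-zero x ⌜ xs ⌝ᵛ
nth-⌜⌝ᵛ (x ∷ xs) (suc i) = trans (nth-suc x ⌜ xs ⌝ᵛ (toℕ i)) (nth-⌜⌝ᵛ xs i)

mutual
  ⌜_⌝ : ∀ {n} → Code n → ℕ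
  ⌜ zer ⌝       = pr 0 0
  ⌜ succ ⌝      = pr 1 0
  ⌜ proj i ⌝    = pr 2 (toℕ i)
  ⌜ comp f gs ⌝ = pr 3 (pr ⌜ f ⌝ ⌜ gs ⌝*)
  ⌜ prec f g ⌝  = pr 4 (pr ⌜ f ⌝ ⌜ g ⌝)
  ⌜ mu f ⌝      = pr 5 ⌜ f ⌝

  -- Vectors of codes receive tags of their own, so that evaluating all entries is a fact of the
  -- same form, with a coded vector as its value.
  ⌜_⌝* : ∀ {m n} → Vec (Code n) m → ℕ
  ⌜ [] ⌝*     = pr 6 0
  ⌜ g ∷ gs ⌝* = pr 7 (pr ⌜ g ⌝ ⌜ gs ⌝*)

-- A fact c [ xs ]⇓ y is coded as pr c (pr xs y). The first L entries of a list d
-- form a derivation if each follows in one step from entries with a larger index.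
fact : ℕ → ℕ → ℕ → ℕ
fact c xs y = pr c (pr xs y)

Facts : Set₁
Facts = ℕ → ℕ → ℕ → Set

PrecStep : ℕ → Facts → (c b x : ℕ) → ℕ → ℕ → Set
PrecStep B S c b x xs y = IfZero x (S (π₁ b) xs y)
  (∃[ z ] (z < B × S c (pr (x ∸ 1) xs) z × S (π₂ b) (pr (x ∸ 1) (pr z xs)) y))

-- The bound B on the witnesses z only serves to make the relation decidable.
Step : ℕ → Facts → Facts
Step B S c xs y =
  IfZero t (y ≡ 0) (
  IfZero (t ∸ 1) (y ≡ suc (π₁ xs)) (
  IfZero (t ∸ 2) (y ≡ nth xs b) (
  IfZero (t ∸ 3) (∃[ z ] (z < B × S (π₂ b) xs z × S (π₁ b) z y)) (
  IfZero (t ∸ 4) (PrecStep B S c b (π₁ xs) (π₂ xs) y) (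
  IfZero (t ∸ 5) (S b (pr y xs) 0
    × (∀ x → x < y → ∃[ z ] (z < B × S b (pr x xs) (suc z)))) (
  IfZero (t ∸ 6) (y ≡ 0)
  (y ≡ pr (π₁ y) (π₂ y) × S (π₁ b) xs (π₁ y) × S (π₂ b) xs (π₂ y))))))))
  where
  t = π₁ c
  b = π₂ c

Listed : ℕ → ℕ → ℕ → Facts
Listed d L i c xs y = ∃[ k ] (k < L × i < k × nth d k ≡ fact c xs y)

listed : ∀ {n} → Fun n → Fun n → Fun n → Fun n → Fun n → Fun n → DecRel n
listed d L i c xs y =
  ex< x0 (x2 <ᴿ x0 ∧ᴿ nthᶠ x3 x0 ≡ᴿ prᶠ x4 (prᶠ x5 x6))
    ⟨ L ∷ i ∷ d ∷ c ∷ xs ∷ y ∷ [] ⟩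

Justified : ℕ → ℕ → ℕ → ℕ → Set
Justified d L B i =
  Step B (Listed d L i) (π₁ (nth d i)) (π₁ (π₂ (nth d i))) (π₂ (π₂ (nth d i)))

-- The variables stand for B, d, L, i, c, xs, y. The clauses copy those of `Step`, so that `Holds`
-- unfolds to it.
step : DecRel 7
step =
  ifzero t (y ≡ᴿ lit 0) (
  ifzero (t ∸ᶠ lit 1) (y ≡ᴿ sucᶠ (π₁ᶠ xs)) (
  ifzero (t ∸ᶠ lit 2) (y ≡ᴿ nthᶠ xs b) (
  ifzero (t ∸ᶠ lit 3) (ex< x0
    (listed x2 x3 x4 (π₂ᶠ (π₂ᶠ x5)) x6 x0 ∧ᴿ listed x2 x3 x4 (π₁ᶠ (π₂ᶠ x5)) x0 x7)) (
  ifzero (t ∸ᶠ lit 4) (ifzero (π₁ᶠ xs)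
    (listed x1 x2 x3 (π₁ᶠ b) (π₂ᶠ xs) y)
    (ex< x0
      (listed x2 x3 x4 x5 (prᶠ (π₁ᶠ x6 ∸ᶠ lit 1) (π₂ᶠ x6)) x0 ∧ᴿ
       listed x2 x3 x4 (π₂ᶠ (π₂ᶠ x5))
         (prᶠ (π₁ᶠ x6 ∸ᶠ lit 1) (prᶠ x0 (π₂ᶠ x6))) x7))) (
  ifzero (t ∸ᶠ lit 5)
    (listed x1 x2 x3 b (prᶠ y xs) (lit 0) ∧ᴿ
     all< y (ex< x1 (listed x3 x4 x5 (π₂ᶠ x6) (prᶠ x1 x7) (sucᶠ x0)))) (
  ifzero (t ∸ᶠ lit 6) (y ≡ᴿ lit 0)
    (y ≡ᴿ prᶠ (π₁ᶠ y) (π₂ᶠ y) ∧ᴿ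
     listed x1 x2 x3 (π₁ᶠ b) xs (π₁ᶠ y) ∧ᴿ listed x1 x2 x3 (π₂ᶠ b) xs (π₂ᶠ y))))))))
  where
  t b xs y : Fun 7
  t  = π₁ᶠ x4
  b  = π₂ᶠ x4
  xs = x5
  y  = x6

justified : DecRel 4
justified = step ⟨ x2 ∷ x0 ∷ x1 ∷ x3 ∷ π₁ᶠ f ∷ π₁ᶠ (π₂ᶠ f) ∷ π₂ᶠ (π₂ᶠ f) ∷ [] ⟩
  where
  f : Fun 4
  f = nthᶠ x0 x3


-- Soundness of derivations

IfZero-map : ∀ k {A A′ B B′ : Set} → (A → A′) → (B → B′) → IfZero k A B → IfZero k A′ B′
IfZero-map zero    f g = f
IfZero-map (suc _) f g = g

Step-mono : ∀ {B B′} {S S′ : Facts} → B ≤ B′ → (∀ c xs y → S c xs y → S′ c xs y) →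
            ∀ c xs y → Step B S c xs y → Step B′ S′ c xs y
Step-mono {B} {B′} {S} {S′} B≤B′ S⊆S′ c xs y =
  IfZero-map t (λ p → p) (
  IfZero-map (t ∸ 1) (λ p → p) (
  IfZero-map (t ∸ 2) (λ p → p) (
  IfZero-map (t ∸ 3)
    (λ (z , z<B , p , q) → z , <-≤-trans z<B B≤B′ , S⊆S′ _ _ _ p , S⊆S′ _ _ _ q) (
  IfZero-map (t ∸ 4) (IfZero-map (π₁ xs) (S⊆S′ _ _ _)
    λ (z , z<B , p , q) → z , <-≤-trans z<B B≤B′ , S⊆S′ _ _ _ p , S⊆S′ _ _ _ q) (
  IfZero-map (t ∸ 5) (λ (p , f) → S⊆S′ _ _ _ p , λ x x<y →
    let z , z<B , q = f x x<y in z , <-≤-trans z<B B≤B′ , S⊆S′ _ _ _ q) (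
  IfZero-map (t ∸ 6) (λ p → p)
  λ (e , p , q) → e , S⊆S′ _ _ _ p , S⊆S′ _ _ _ q))))))
  where
  t = π₁ c

-- Only facts about numbers of genuine codes are judged; a derivation may also contain entries that
-- code nothing.
record Sound (S : Facts) : Set where
  field
    code : ∀ {n} (c : Code n) xs y → S ⌜ c ⌝ ⌜ xs ⌝ᵛ y → c [ xs ]⇓ y
    vec  : ∀ {m n} (gs : Vec (Code n) m) xs y → S ⌜ gs ⌝* ⌜ xs ⌝ᵛ y →
           ∃[ zs ] (y ≡ ⌜ zs ⌝ᵛ × gs [ xs ]⇓* zs)

Step-sound : ∀ {B S} → Sound S → Sound (Step B S)
Step-sound {B} {S} snd = record { code = code ; vec = vec }
  where
  module S = Sound snd
  code : ∀ {n} (c : Code n) xs y → Step B S ⌜ c ⌝ ⌜ xs ⌝ᵛ y → c [ xs ]⇓ y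
  code zer xs y s rewrite π₁-pr 0 0 = s
  code succ (x ∷ []) y s rewrite π₁-pr 1 0 | π₁-pr x 0 = s
  code (proj i) xs y s
    rewrite π₁-pr 2 (toℕ i) | π₂-pr 2 (toℕ i) | nth-⌜⌝ᵛ xs i = s
  code (comp f gs) xs y s
    rewrite π₁-pr 3 (pr ⌜ f ⌝ ⌜ gs ⌝*) | π₂-pr 3 (pr ⌜ f ⌝ ⌜ gs ⌝*)
          | π₁-pr ⌜ f ⌝ ⌜ gs ⌝* | π₂-pr ⌜ f ⌝ ⌜ gs ⌝*
    with z , _ , p , q ← s
    with zs , refl , r ← S.vec gs xs z p = zs , r , S.code f zs y q
  code (prec f g) (zero ∷ xs) y s
    rewrite π₁-pr 4 (pr ⌜ f ⌝ ⌜ g ⌝) | π₂-pr 4 (pr ⌜ f ⌝ ⌜ g ⌝)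
          | π₁-pr 0 ⌜ xs ⌝ᵛ | π₂-pr 0 ⌜ xs ⌝ᵛ | π₁-pr ⌜ f ⌝ ⌜ g ⌝ = S.code f xs y s
  code (prec f g) (suc k ∷ xs) y s
    rewrite π₁-pr 4 (pr ⌜ f ⌝ ⌜ g ⌝) | π₂-pr 4 (pr ⌜ f ⌝ ⌜ g ⌝)
          | π₁-pr (suc k) ⌜ xs ⌝ᵛ | π₂-pr (suc k) ⌜ xs ⌝ᵛ | π₂-pr ⌜ f ⌝ ⌜ g ⌝
    with z , _ , p , q ← s =
      z , S.code (prec f g) (k ∷ xs) z p , S.code g (k ∷ z ∷ xs) y q
  code (mu f) xs y s
    rewrite π₁-pr 5 ⌜ f ⌝ | π₂-pr 5 ⌜ f ⌝ with p , q ← s =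
      S.code f (y ∷ xs) 0 p ,
      λ x x<y → let z , _ , r = q x x<y in z , S.code f (x ∷ xs) (suc z) r
  vec : ∀ {m n} (gs : Vec (Code n) m) xs y → Step B S ⌜ gs ⌝* ⌜ xs ⌝ᵛ y →
        ∃[ zs ] (y ≡ ⌜ zs ⌝ᵛ × gs [ xs ]⇓* zs)
  vec [] xs y s rewrite π₁-pr 6 0 = [] , s , tt
  vec (g ∷ gs) xs y s
    rewrite π₁-pr 7 (pr ⌜ g ⌝ ⌜ gs ⌝*) | π₂-pr 7 (pr ⌜ g ⌝ ⌜ gs ⌝*)
          | π₁-pr ⌜ g ⌝ ⌜ gs ⌝* | π₂-pr ⌜ g ⌝ ⌜ gs ⌝*
    with e , p , q ← s
    with zs , e′ , r ← S.vec gs xs (π₂ y) q =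
      -- As the pairing is not onto, the step itself has to provide the equation `e` that makes y a
      -- pair.
      π₁ y ∷ zs , trans e (cong (pr (π₁ y)) e′) , S.code g xs (π₁ y) p , r

AllJustified : ℕ → ℕ → ℕ → Set
AllJustified d L B = ∀ i → i < L → Justified d L B i

Justified⇒Step : ∀ {d L B i c xs y} → nth d i ≡ fact c xs y → Justified d L B i →
                 Step B (Listed d L i) c xs y
Justified⇒Step {c = c} {xs} {y} e j
  rewrite e | π₁-pr c (pr xs y) | π₂-pr c (pr xs y) | π₁-pr xs y | π₂-pr xs y = j

Step⇒Justified : ∀ {d L B i c xs y} → nth d i ≡ fact c xs y →
                 Step B (Listed d L i) c xs y → Justified d L B i
Step⇒Justified {c = c} {xs} {y} e s
  rewrite e | π₁-pr c (pr xs y) | π₂-pr c (pr xs y) | π₁-pr xs y | π₂-pr xs y = s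

-- A justification refers only to entries of larger index, so induction on a bound n for the number
-- of entries from i on reaches the end of the list.
Listed-sound : ∀ {d L B} → AllJustified d L B → ∀ n i → L ≤ n + i → Sound (Listed d L i)
Listed-sound {d} {L} {B} ok n i L≤n+i = record
  { code = λ c xs y l → Sound.code (earlier n L≤n+i l) c xs y (derived l)
  ; vec  = λ gs xs y l → Sound.vec (earlier n L≤n+i l) gs xs y (derived l)
  }
  where
  earlier : ∀ n → L ≤ n + i → ∀ {c xs y} (l : Listed d L i c xs y) →
            Sound (Step B (Listed d L (proj₁ l)))
  earlier zero    L≤i     (k , k<L , i<k , _) =
    contradiction (≤-trans k<L L≤i) (<⇒≱ (m<n⇒m<1+n i<k))
  earlier (suc n) L≤1+n+i (k , k<L , i<k , _) = Step-sound (Listed-sound ok n k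
    (≤-trans L≤1+n+i (≤-trans (≤-reflexive (sym (+-suc n i))) (+-monoʳ-≤ n i<k))))
  derived : ∀ {c xs y} (l : Listed d L i c xs y) → Step B (Listed d L (proj₁ l)) c xs y
  derived {c} {xs} {y} (k , k<L , _ , e) = Justified⇒Step {c = c} {xs} {y} e (ok k k<L)

-- Completeness of derivations

_∋_ : List ℕ → Facts
(l ∋ c) xs y = fact c xs y ∈ l

infixr 5 _∷_

data Derivation (B : ℕ) : List ℕ → Set where
  []  : Derivation B []
  _∷_ : ∀ {l c xs y} → Step B (l ∋_) c xs y → Derivation B l →
        Derivation B (fact c xs y ∷ l)

weaken : ∀ {B B′ l} → B ≤ B′ → Derivation B l → Derivation B′ l
weaken B≤B′ []                  = []
weaken {B} {B′} B≤B′ (_∷_ {l} {c} {xs} {y} s d) =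
  Step-mono {S = l ∋_} {S′ = l ∋_} B≤B′ (λ _ _ _ p → p) c xs y s ∷ weaken B≤B′ d

append : ∀ {B l l′} → Derivation B l → Derivation B l′ → Derivation B (l ++ l′)
append []       d′ = d′
append {B} {l′ = l′} (_∷_ {l} {c} {xs} {y} s d) d′ =
  Step-mono {B} {B} {S = l ∋_} {S′ = (l ++ l′) ∋_} ≤-refl (λ _ _ _ → ∈-++⁺ˡ) c xs y s
    ∷ append d d′

⌜_⌝ˡ : List ℕ → ℕ
⌜ [] ⌝ˡ    = 0
⌜ f ∷ l ⌝ˡ = pr f ⌜ l ⌝ˡ

∈⇒nth : ∀ {f l} → f ∈ l → ∃[ k ] (k < length l × nth ⌜ l ⌝ˡ k ≡ f)
∈⇒nth {l = f ∷ l} (here refl) = 0 , s≤s z≤n , nth-zero f ⌜ l ⌝ˡ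
∈⇒nth {l = g ∷ l} (there p)   = let k , k< , e = ∈⇒nth p in
  suc k , s≤s k< , trans (nth-suc g ⌜ l ⌝ˡ k) e

Derivation⇒AllJustified : ∀ {B l} → Derivation B l → AllJustified ⌜ l ⌝ˡ (length l) B
Derivation⇒AllJustified {B} (_∷_ {l} {c} {xs} {y} s d) zero _ =
  Step⇒Justified {c = c} {xs} {y} (nth-zero f ⌜ l ⌝ˡ)
    (Step-mono {B} {B} {S = l ∋_} {S′ = Listed ⌜ f ∷ l ⌝ˡ (suc (length l)) 0} ≤-refl
      (λ _ _ _ p → let k , k< , e = ∈⇒nth p in
        suc k , s≤s k< , s≤s z≤n , trans (nth-suc f ⌜ l ⌝ˡ k) e)
      c xs y s)
  where
  f = fact c xs y
Derivation⇒AllJustified {B} (_∷_ {l} {c} {xs} {y} s d) (suc i) (s≤s i<) =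
  subst (λ g → Step B (Listed ⌜ f ∷ l ⌝ˡ (suc (length l)) (suc i))
                 (π₁ g) (π₁ (π₂ g)) (π₂ (π₂ g)))
    (sym (nth-suc f ⌜ l ⌝ˡ i))
    (Step-mono {B} {B} {S = Listed ⌜ l ⌝ˡ (length l) i}
       {S′ = Listed ⌜ f ∷ l ⌝ˡ (suc (length l)) (suc i)} ≤-refl
      (λ _ _ _ (k , k< , i<k , e) → suc k , s≤s k< , s≤s i<k , trans (nth-suc f ⌜ l ⌝ˡ k) e)
      _ _ _ (Derivation⇒AllJustified d i i<))
  where
  f = fact c xs y

Derivable : Facts
Derivable c xs y = ∃[ B ] ∃[ l ] (Derivation B l × (l ∋ c) xs y)

-- The number C leaves room for the witness of the step that is going to be put on top of both
-- derivations.
join : ∀ {B B′ l l′} C → Derivation B l → Derivation B′ l′ →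
       Derivation (C ⊔ (B ⊔ B′)) (l ++ l′)
join {B} {B′} C d d′ = append
  (weaken (≤-trans (m≤m⊔n B B′) (m≤n⊔m C (B ⊔ B′))) d)
  (weaken (≤-trans (m≤n⊔m B B′) (m≤n⊔m C (B ⊔ B′))) d′)

conclude : ∀ {B l c xs y} → Derivation B l → Step B (l ∋_) c xs y → Derivable c xs y
conclude d s = _ , _ , s ∷ d , here refl

mutual
  derivable : ∀ {n} (c : Code n) xs y → c [ xs ]⇓ y → Derivable ⌜ c ⌝ ⌜ xs ⌝ᵛ y
  derivable {n} zer xs y p = conclude {0} [] step-zer
    where
    step-zer : Step 0 ([] ∋_) ⌜ zer {n} ⌝ ⌜ xs ⌝ᵛ y
    step-zer rewrite π₁-pr 0 0 = p
  derivable succ (x ∷ []) y p = conclude {0} [] step-succ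
    where
    step-succ : Step 0 ([] ∋_) ⌜ succ ⌝ ⌜ x ∷ [] ⌝ᵛ y
    step-succ rewrite π₁-pr 1 0 | π₁-pr x 0 = p
  derivable (proj i) xs y p = conclude {0} [] step-proj
    where
    step-proj : Step 0 ([] ∋_) ⌜ proj i ⌝ ⌜ xs ⌝ᵛ y
    step-proj rewrite π₁-pr 2 (toℕ i) | π₂-pr 2 (toℕ i) | nth-⌜⌝ᵛ xs i = p
  derivable (comp f gs) xs y (zs , p , q)
    with B , l , d , m ← derivable* gs xs zs p
    with B′ , l′ , d′ , m′ ← derivable f zs y q =
      conclude (join (suc ⌜ zs ⌝ᵛ) d d′) step-comp
    where
    step-comp : Step (suc ⌜ zs ⌝ᵛ ⊔ (B ⊔ B′)) ((l ++ l′) ∋_) ⌜ comp f gs ⌝ ⌜ xs ⌝ᵛ y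
    step-comp
      rewrite π₁-pr 3 (pr ⌜ f ⌝ ⌜ gs ⌝*) | π₂-pr 3 (pr ⌜ f ⌝ ⌜ gs ⌝*)
            | π₁-pr ⌜ f ⌝ ⌜ gs ⌝* | π₂-pr ⌜ f ⌝ ⌜ gs ⌝* =
        ⌜ zs ⌝ᵛ , m≤m⊔n (suc ⌜ zs ⌝ᵛ) (B ⊔ B′) , ∈-++⁺ˡ m , ∈-++⁺ʳ l m′
  derivable (prec f g) (zero ∷ xs) y p
    with B , l , d , m ← derivable f xs y p = conclude d step-base
    where
    step-base : Step B (l ∋_) ⌜ prec f g ⌝ ⌜ zero ∷ xs ⌝ᵛ y
    step-base
      rewrite π₁-pr 4 (pr ⌜ f ⌝ ⌜ g ⌝) | π₂-pr 4 (pr ⌜ f ⌝ ⌜ g ⌝)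
            | π₁-pr 0 ⌜ xs ⌝ᵛ | π₂-pr 0 ⌜ xs ⌝ᵛ | π₁-pr ⌜ f ⌝ ⌜ g ⌝ = m
  derivable (prec f g) (suc k ∷ xs) y (r , p , q)
    with B , l , d , m ← derivable (prec f g) (k ∷ xs) r p
    with B′ , l′ , d′ , m′ ← derivable g (k ∷ r ∷ xs) y q =
      conclude (join (suc r) d d′) step-prec
    where
    step-prec : Step (suc r ⊔ (B ⊔ B′)) ((l ++ l′) ∋_) ⌜ prec f g ⌝ ⌜ suc k ∷ xs ⌝ᵛ y
    step-prec
      rewrite π₁-pr 4 (pr ⌜ f ⌝ ⌜ g ⌝) | π₂-pr 4 (pr ⌜ f ⌝ ⌜ g ⌝)
            | π₁-pr (suc k) ⌜ xs ⌝ᵛ | π₂-pr (suc k) ⌜ xs ⌝ᵛ | π₂-pr ⌜ f ⌝ ⌜ g ⌝ =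
        r , m≤m⊔n (suc r) (B ⊔ B′) , ∈-++⁺ˡ m , ∈-++⁺ʳ l m′
  derivable (mu f) xs y (p , p<)
    with B , l , d , m ← derivable f (y ∷ xs) 0 p
    with B′ , l′ , d′ , m′ ← derivable-below f xs y p< =
      conclude (join 0 d d′) step-mu
    where
    step-mu : Step (0 ⊔ (B ⊔ B′)) ((l ++ l′) ∋_) ⌜ mu f ⌝ ⌜ xs ⌝ᵛ y
    step-mu rewrite π₁-pr 5 ⌜ f ⌝ | π₂-pr 5 ⌜ f ⌝ =
      ∈-++⁺ˡ m , λ x x<y → let z , z<B′ , r = m′ x x<y in
        z , <-≤-trans z<B′ (m≤n⊔m B B′) , ∈-++⁺ʳ l r

  -- The minimality condition of `mu` needs a value at each x below y; all their derivations are
  -- collected in one list.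
  derivable-below : ∀ {n} (f : Code (suc n)) xs y →
    (∀ x → x < y → ∃[ z ] f [ x ∷ xs ]⇓ suc z) →
    ∃[ B ] ∃[ l ] (Derivation B l ×
      (∀ x → x < y → ∃[ z ] (z < B × (l ∋ ⌜ f ⌝) (pr x ⌜ xs ⌝ᵛ) (suc z))))
  derivable-below f xs zero    p< = 0 , [] , [] , λ _ ()
  derivable-below f xs (suc y) p<
    with B , l , d , m ← derivable-below f xs y (λ x x<y → p< x (m<n⇒m<1+n x<y))
    with z , p ← p< y ≤-refl
    with B′ , l′ , d′ , m′ ← derivable f (y ∷ xs) (suc z) p =
      _ , _ , join (suc z) d d′ , below
    where
    below : ∀ x → x < suc y →
      ∃[ v ] (v < suc z ⊔ (B ⊔ B′) × ((l ++ l′) ∋ ⌜ f ⌝) (pr x ⌜ xs ⌝ᵛ) (suc v))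
    below x x<1+y with m≤n⇒m<n∨m≡n (≤-pred x<1+y)
    ... | inj₁ x<y  = let v , v<B , r = m x x<y in
      v , <-≤-trans v<B (≤-trans (m≤m⊔n B B′) (m≤n⊔m (suc z) (B ⊔ B′))) , ∈-++⁺ˡ r
    ... | inj₂ refl = z , m≤m⊔n (suc z) (B ⊔ B′) , ∈-++⁺ʳ l m′

  derivable* : ∀ {m n} (gs : Vec (Code n) m) xs zs → gs [ xs ]⇓* zs →
               Derivable ⌜ gs ⌝* ⌜ xs ⌝ᵛ ⌜ zs ⌝ᵛ
  derivable* [] xs [] _ = conclude {0} [] step-nil
    where
    step-nil : Step 0 ([] ∋_) (pr 6 0) ⌜ xs ⌝ᵛ 0
    step-nil rewrite π₁-pr 6 0 = refl
  derivable* (g ∷ gs) xs (z ∷ zs) (p , q)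
    with B , l , d , m ← derivable g xs z p
    with B′ , l′ , d′ , m′ ← derivable* gs xs zs q = conclude (join 0 d d′) step-cons
    where
    step-cons : Step (0 ⊔ (B ⊔ B′)) ((l ++ l′) ∋_) ⌜ g ∷ gs ⌝* ⌜ xs ⌝ᵛ ⌜ z ∷ zs ⌝ᵛ
    step-cons
      rewrite π₁-pr 7 (pr ⌜ g ⌝ ⌜ gs ⌝*) | π₂-pr 7 (pr ⌜ g ⌝ ⌜ gs ⌝*)
            | π₁-pr ⌜ g ⌝ ⌜ gs ⌝* | π₂-pr ⌜ g ⌝ ⌜ gs ⌝* | π₁-pr z ⌜ zs ⌝ᵛ | π₂-pr z ⌜ zs ⌝ᵛ =
        refl , ∈-++⁺ˡ m , ∈-++⁺ʳ l m′

-- j = pr ⌜ c ⌝ a stands for the function x ↦ c [ a ∷ x ∷ [] ]; a computation s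
-- codes its value together with a derivation of it.
Run : ℕ → ℕ → ℕ → Set
Run j x s = AllJustified d L B × Listed (pr 0 d) (suc L) 0 (π₁ j) (pr (π₂ j) (pr x 0)) (π₁ s)
  where
  d = π₁ (π₂ s)
  L = π₁ (π₂ (π₂ s))
  B = π₂ (π₂ (π₂ s))

Run-sound : ∀ (c : Code 2) a x s → Run (pr ⌜ c ⌝ a) x s → c [ a ∷ x ∷ [] ]⇓ π₁ s
-- The list in `Run` starts with a dummy entry, so that every entry of the derivation lies beyond
-- index 0; hence the shift from k + 1 to k.
Run-sound c a x s (ok , suc k , s≤s k<L , _ , e)
  rewrite nth-suc 0 (π₁ (π₂ s)) k | π₁-pr ⌜ c ⌝ a | π₂-pr ⌜ c ⌝ a =
    Sound.code (Step-sound (Listed-sound ok _ k (m≤m+n _ k))) c (a ∷ x ∷ []) (π₁ s)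
      (Justified⇒Step {c = ⌜ c ⌝} {pr a (pr x 0)} {π₁ s} e (ok k k<L))

Run-complete : ∀ (c : Code 2) a x y → c [ a ∷ x ∷ [] ]⇓ y →
               ∃[ s ] (Run (pr ⌜ c ⌝ a) x s × π₁ s ≡ y)
Run-complete c a x y p with B , l , d , m ← derivable c (a ∷ x ∷ []) y p = s , run-s , π₁-pr y (pr ⌜ l ⌝ˡ (pr (length l) B))
  where
  s = pr y (pr ⌜ l ⌝ˡ (pr (length l) B))
  run-s : Run (pr ⌜ c ⌝ a) x s
  run-s rewrite π₁-pr y (pr ⌜ l ⌝ˡ (pr (length l) B)) | π₂-pr y (pr ⌜ l ⌝ˡ (pr (length l) B))
              | π₁-pr ⌜ l ⌝ˡ (pr (length l) B) | π₂-pr ⌜ l ⌝ˡ (pr (length l) B)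
              | π₁-pr (length l) B | π₂-pr (length l) B
              | π₁-pr ⌜ c ⌝ a | π₂-pr ⌜ c ⌝ a =
    Derivation⇒AllJustified d , let k , k< , e = ∈⇒nth m in
      suc k , s≤s k< , s≤s z≤n , trans (nth-suc 0 ⌜ l ⌝ˡ k) e

run : DecRel 3
run = all< L (justified ⟨ π₁ᶠ (π₂ᶠ x3) ∷ π₁ᶠ (π₂ᶠ (π₂ᶠ x3)) ∷ π₂ᶠ (π₂ᶠ (π₂ᶠ x3)) ∷ x0 ∷ [] ⟩)
  ∧ᴿ listed (prᶠ (lit 0) d) (sucᶠ L) (lit 0) (π₁ᶠ x0) (prᶠ (π₂ᶠ x0) (prᶠ x1 (lit 0))) (π₁ᶠ x2)
  where
  d L : Fun 3
  d = π₁ᶠ (π₂ᶠ x2)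
  L = π₁ᶠ (π₂ᶠ (π₂ᶠ x2))

opaque
  -- w = pr x s is the least code of a computation of j at x.
  Hit : ℕ → ℕ → Set
  Hit j w = Run j (π₁ w) (π₂ w) × (∀ v → v < w → π₁ v ≡ π₁ w → ¬ Run j (π₁ v) (π₂ v))

arg val : ℕ → ℕ
arg w = π₁ w
val w = π₁ (π₂ w)

argᶠ valᶠ : ∀ {n} → Fun n → Fun n
argᶠ w = π₁ᶠ w
valᶠ w = π₁ᶠ (π₂ᶠ w)

hitTerm : DecRel 2
hitTerm = run ⟨ x0 ∷ π₁ᶠ x1 ∷ π₂ᶠ x1 ∷ [] ⟩ ∧ᴿ
  all< x1 (π₁ᶠ x0 ≡ᴿ π₁ᶠ x2 ⇒ᴿ ¬ᴿ run ⟨ x1 ∷ π₁ᶠ x0 ∷ π₂ᶠ x0 ∷ [] ⟩)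

opaque
  unfolding Hit

  Hit? : ∀ j w → Dec (Hit j w)
  Hit? j w = holds? hitTerm (j ∷ w ∷ [])

  hitTerm-computes : ∀ j w → R.code hitTerm [ j ∷ w ∷ [] ]⇓ ind (Hit? j w)
  hitTerm-computes j w = R.computes hitTerm (j ∷ w ∷ [])

  -- Counting hits thus means counting arguments, which makes the size of a finite part depend on
  -- its graph only.
  Hit-unique : ∀ {j v w} → Hit j v → Hit j w → arg v ≡ arg w → v ≡ w
  Hit-unique {j} {v} {w} (rv , v-least) (rw , w-least) e with <-cmp v w
  ... | tri≈ _ v≡w _ = v≡w
  ... | tri< v<w _ _ = contradiction rv (w-least v v<w e)
  ... | tri> _ _ w<v = contradiction rw (v-least w w<v (sym e))

  Hit-sound : ∀ (c : Code 2) a w → Hit (pr ⌜ c ⌝ a) w → c [ a ∷ arg w ∷ [] ]⇓ val w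
  Hit-sound c a w (r , _) = Run-sound c a (π₁ w) (π₂ w) r

  Hit-complete : ∀ (c : Code 2) a x y → c [ a ∷ x ∷ [] ]⇓ y →
                 ∃[ w ] (Hit (pr ⌜ c ⌝ a) w × arg w ≡ x × val w ≡ y)
  Hit-complete c a x y p = first-hit (Run-complete c a x y p)
    where
    P : ℕ → Set
    P w = π₁ w ≡ x × Run (pr ⌜ c ⌝ a) (π₁ w) (π₂ w)
    P? : ∀ w → Dec (P w)
    P? w = (π₁ w ≟ x) ×-dec holds? run (pr ⌜ c ⌝ a ∷ π₁ w ∷ π₂ w ∷ [])
    first-hit : ∃[ s ] (Run (pr ⌜ c ⌝ a) x s × π₁ s ≡ y) →
                ∃[ w ] (Hit (pr ⌜ c ⌝ a) w × arg w ≡ x × val w ≡ y)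
    first-hit (s , r , e) = let w , (ew , rw) , w-least = least P? (pr x s) P-pr in
      w , (rw , λ v v<w ev rv → w-least v v<w (trans ev ew , rv)) , ew ,
      ⇓-functional c (a ∷ x ∷ [])
        (subst (λ x → c [ a ∷ x ∷ [] ]⇓ val w) ew (Run-sound c a (π₁ w) (π₂ w) rw)) p
      where
      P-pr : P (pr x s)
      P-pr = π₁-pr x s , subst₂ (Run (pr ⌜ c ⌝ a)) (sym (π₁-pr x s)) (sym (π₂-pr x s)) r

hit : ∀ {n} → Fun n → Fun n → DecRel n
hit j w = record
  { Holds    = λ { (j ∷ w ∷ []) → Hit j w }
  ; holds?   = λ { (j ∷ w ∷ []) → Hit? j w }
  ; code     = R.code hitTerm
  ; computes = λ { (j ∷ w ∷ []) → hitTerm-computes j w }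
  } ⟨ j ∷ w ∷ [] ⟩

-- The construction

cnt-mono : ∀ {P : ℕ → Set} (P? : ∀ i → Dec (P i)) {m n} → m ≤ n → cnt P? m ≤ cnt P? n
cnt-mono P? {n = zero}  z≤n = z≤n
cnt-mono P? {m} {suc n} m≤1+n with m≤n⇒m<n∨m≡n m≤1+n
... | inj₁ m<1+n = ≤-trans (cnt-mono P? (≤-pred m<1+n)) (m≤m+n (cnt P? n) (ind (P? n)))
... | inj₂ refl  = ≤-refl

ind≤1 : {P : Set} (d : Dec P) → ind d ≤ 1
ind≤1 (yes _) = ≤-refl
ind≤1 (no _)  = z≤n

cnt≤ : ∀ {P : ℕ → Set} (P? : ∀ i → Dec (P i)) n → cnt P? n ≤ n
cnt≤ P? zero    = z≤n
cnt≤ P? (suc n) = ≤-trans (+-mono-≤ (cnt≤ P? n) (ind≤1 (P? n))) (≤-reflexive (+-comm n 1))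

cnt-cong : ∀ {P Q : ℕ → Set} (P? : ∀ i → Dec (P i)) (Q? : ∀ i → Dec (Q i)) n →
           (∀ i → i < n → P i → Q i) → (∀ i → i < n → Q i → P i) → cnt P? n ≡ cnt Q? n
cnt-cong P? Q? zero    f g = refl
cnt-cong {P} {Q} P? Q? (suc n) f g = cong₂ _+_
  (cnt-cong P? Q? n (λ i i<n → f i (m<n⇒m<1+n i<n)) (λ i i<n → g i (m<n⇒m<1+n i<n)))
  (go (P? n) (Q? n))
  where
  go : (d : Dec (P n)) (e : Dec (Q n)) → ind d ≡ ind e
  go (yes p) e = sym (ind≡1 e (f n ≤-refl p))
  go (no ¬p) e = sym (¬⇒ind≡0 e λ q → ¬p (g n ≤-refl q))

cnt-remove : ∀ {Q : ℕ → Set} (Q? : ∀ i → Dec (Q i)) a → Q a → ∀ n → a < n →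
             cnt Q? n ≡ suc (cnt (λ i → Q? i ×-dec ¬? (i ≟ a)) n)
cnt-remove {Q} Q? a qa (suc n) a<1+n with m≤n⇒m<n∨m≡n (≤-pred a<1+n)
... | inj₁ a<n = cong₂ _+_ (cnt-remove Q? a qa n a<n)
  (go (Q? n) (Q? n ×-dec ¬? (n ≟ a)))
  where
  go : (d : Dec (Q n)) (e : Dec (Q n × ¬ n ≡ a)) → ind d ≡ ind e
  go (yes q) e = sym (ind≡1 e (q , λ { refl → <-irrefl refl a<n }))
  go (no ¬q) e = sym (¬⇒ind≡0 e λ (q , _) → ¬q q)
... | inj₂ refl = begin
  cnt Q? n + ind (Q? n)         ≡⟨ cong₂ _+_ same (ind≡1 (Q? n) qa) ⟩
  cnt Q′? n + 1                 ≡⟨ +-comm (cnt Q′? n) 1 ⟩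
  suc (cnt Q′? n)               ≡⟨ cong suc (sym (+-identityʳ (cnt Q′? n))) ⟩
  suc (cnt Q′? n + 0)           ≡⟨ cong (λ k → suc (cnt Q′? n + k)) (sym removed) ⟩
  suc (cnt Q′? n + ind (Q′? n)) ∎
  where
  open ≡-Reasoning
  Q′? : ∀ i → Dec (Q i × ¬ i ≡ n)
  Q′? i = Q? i ×-dec ¬? (i ≟ n)
  same : cnt Q? n ≡ cnt Q′? n
  same = cnt-cong Q? Q′? n (λ i i<n q → q , λ { refl → <-irrefl refl i<n }) (λ _ _ → proj₁)
  removed : ind (Q′? n) ≡ 0
  removed = ¬⇒ind≡0 (Q′? n) λ (_ , n≢n) → n≢n refl

-- Induction on m: the image `a` of the top element is removed from Q, which lowers that count by
-- one.
cnt-injection : ∀ (M : ℕ → ℕ → Set) → (∀ {v w a} → M v a → M w a → v ≡ w) →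
  ∀ m n {P Q : ℕ → Set} (P? : ∀ i → Dec (P i)) (Q? : ∀ i → Dec (Q i)) →
  (∀ w → w < m → P w → ∃[ a ] (a < n × Q a × M w a)) → cnt P? m ≤ cnt Q? n
cnt-injection M inj zero    n P? Q? f = z≤n
cnt-injection M inj (suc m) n {P} {Q} P? Q? f with P? m
... | no _  = ≤-trans (≤-reflexive (+-identityʳ (cnt P? m)))
  (cnt-injection M inj m n P? Q? λ w w<m → f w (m<n⇒m<1+n w<m))
... | yes p with a , a<n , qa , ma ← f m ≤-refl p = begin
  cnt P? m + 1      ≡⟨ +-comm (cnt P? m) 1 ⟩
  suc (cnt P? m)    ≤⟨ s≤s (cnt-injection M inj m n P? Q′? f′) ⟩
  suc (cnt Q′? n)   ≡⟨ sym (cnt-remove Q? a qa n a<n) ⟩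
  cnt Q? n          ∎
  where
  open ≤-Reasoning
  Q′? : ∀ i → Dec (Q i × ¬ i ≡ a)
  Q′? i = Q? i ×-dec ¬? (i ≟ a)
  f′ : ∀ w → w < m → P w → ∃[ b ] (b < n × (Q b × ¬ b ≡ a) × M w b)
  f′ w w<m pw with b , b<n , qb , mb ← f w (m<n⇒m<1+n w<m) pw =
    b , b<n , (qb , λ { refl → <-irrefl (inj mb ma) w<m }) , mb

-- In j t is the graph of the finite function E(j,t) formed by the hits of j below t.
In : ℕ → ℕ → ℕ → ℕ → Set
In j t x y = ∃[ w ] (w < t × Hit j w × arg w ≡ x × val w ≡ y)

Sub Same : ℕ → ℕ → ℕ → ℕ → Set
Sub j t i u  = ∀ w → w < t → Hit j w → In i u (arg w) (val w)
Same j t i u = Sub j t i u × Sub i u j t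

-- `own` names the function that may take over the finite part, and `widx` the function whose values
-- are watched for indices of it.
size own widx : ℕ → ℕ → ℕ
size j t = cnt (Hit? j) t
own j t  = π₁ (size j t)
widx j t = π₂ (size j t)

Visited : ℕ → ℕ → Set
Visited j v = own j v ≡ j

Total : ℕ → ℕ → ℕ → Set
Total j x y = ∃[ w ] (Hit j w × arg w ≡ x × val w ≡ y)

In⇒Total : ∀ {j t x y} → In j t x y → Total j x y
In⇒Total (w , _ , h) = w , h

Total-functional : ∀ {j x y z} → Total j x y → Total j x z → y ≡ z
Total-functional (v , hv , av , refl) (w , hw , aw , refl) =
  cong val (Hit-unique hv hw (trans av (sym aw)))

In-mono : ∀ {j t i u x y} → Sub j t i u → In j t x y → In i u x y
In-mono s (w , w<t , h , refl , refl) = s w w<t h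

Sub-trans : ∀ {j t i u k v} → Sub j t i u → Sub i u k v → Sub j t k v
Sub-trans {k = k} {v} s s′ w w<t h = In-mono {i = k} {v} s′ (s w w<t h)

≤⇒Sub : ∀ {j t u} → t ≤ u → Sub j t j u
≤⇒Sub t≤u w w<t h = w , <-≤-trans w<t t≤u , h , refl , refl

Same-refl : ∀ {j t} → Same j t j t
Same-refl {j} = ≤⇒Sub {j} ≤-refl , ≤⇒Sub {j} ≤-refl

Same-sym : ∀ {j t i u} → Same j t i u → Same i u j t
Same-sym (s , s′) = s′ , s

Same-trans : ∀ {j t i u k v} → Same j t i u → Same i u k v → Same j t k v
Same-trans {j} {t} {i} {u} {k} {v} (a , a′) (b , b′) =
  Sub-trans {j} {t} {i} {u} {k} {v} a b , Sub-trans {k} {v} {i} {u} {j} {t} b′ a′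

Sub⇒size≤ : ∀ {j t i u} → Sub j t i u → size j t ≤ size i u
Sub⇒size≤ {j} {t} {i} {u} s = cnt-injection (λ w a → Hit j w × arg a ≡ arg w)
  (λ (hv , ev) (hw , ew) → Hit-unique hv hw (trans (sym ev) ew)) t u (Hit? j) (Hit? i)
  λ w w<t h → let a , a<u , ha , e , _ = s w w<t h in a , a<u , ha , h , e

Same⇒size≡ : ∀ {j t i u} → Same j t i u → size j t ≡ size i u
Same⇒size≡ {j} {t} {i} {u} (s , s′) =
  ≤-antisym (Sub⇒size≤ {j} {t} {i} {u} s) (Sub⇒size≤ {i} {u} {j} {t} s′)

-- The size grows by at most one per stage, so no number is skipped.
size-reaches : ∀ j n t → n ≤ size j t → ∃[ v ] size j v ≡ n
size-reaches j n zero    n≤0 = zero , sym (n≤0⇒n≡0 n≤0)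
size-reaches j n (suc t) n≤  with m≤n⇒m<n∨m≡n n≤
... | inj₂ n≡ = suc t , sym n≡
... | inj₁ n< = size-reaches j n t (≤-pred (≤-trans n<
  (≤-trans (+-monoʳ-≤ (size j t) (ind≤1 (Hit? j t))) (≤-reflexive (+-comm (size j t) 1)))))

Finite : ℕ → Set
Finite j = ∃[ T ] (∀ w → Hit j w → w < T)

-- An index p = (i, u, s) starts out as a program for the finite function E(i,u)
-- of size n; n is decoded as a pair (own, widx).
base bound since : ℕ → ℕ
base p  = π₁ p
bound p = π₁ (π₂ p)
since p = π₂ (π₂ p)

owner : ℕ → ℕ
owner p = own (base p) (bound p)

Pass : ℕ → ℕ → ℕ → ℕ → Set
Pass j i u t = ∃[ v ] (v < suc t × Same j v i u)

-- E(i,u) is the last finite function visited by j before stage t.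
Sits : ℕ → ℕ → ℕ → ℕ → Set
Sits j i u t = Pass j i u t × (∀ v → v < suc t → Visited j v → Sub j v i u)

-- Before stage t the e-th function has taken an index of E(i,u) as a value.
Caught : ℕ → ℕ → ℕ → ℕ → Set
Caught e i u t = ∃[ k ] (k < t × Hit e k × Same (base (val k)) (bound (val k)) i u
                                × since (val k) ≤ t)

Met : ℕ → ℕ → ℕ → ℕ → ℕ → Set
Met j e i u t = Pass j i u t × Caught e i u t

-- Only the first meeting counts, so that this event happens at most once and indices with a later
-- `since` escape it.
FirstMet : ℕ → ℕ → ℕ → ℕ → ℕ → Set
FirstMet j e i u t = Met j e i u t × (∀ t′ → t′ < t → ¬ Met j e i u t′)

EventFor : ℕ → ℕ → ℕ → ℕ → ℕ → Set
EventFor j e i u t = Sits j i u t ⊎ FirstMet j e i u t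

-- At such a stage all indices (i, u, s) with s ≤ t are handed over to own i u.
Event : ℕ → ℕ → ℕ → Set
Event i u t = EventFor (own i u) (widx i u) i u t

HandedAt : ℕ → ℕ → ℕ → Set
HandedAt i u s = ∃[ t ] (s ≤ t × Event i u t)

Handed : ℕ → Set
Handed p = HandedAt (base p) (bound p) (since p)

Followed : ℕ → ℕ → ℕ → Set
Followed j x y = ∃[ v ] (Visited j v × In j v x y)

ΨAt : ℕ → ℕ → ℕ → ℕ → ℕ → Set
ΨAt i u s x y = In i u x y ⊎ (HandedAt i u s × Followed (own i u) x y)

Ψ : ℕ → ℕ → ℕ → Set
Ψ p = ΨAt (base p) (bound p) (since p)

-- Not being handed over is not an enumerable condition. The second clause asks instead that no
-- event separates p from q; then both are handed over or neither is.
Tied : ℕ → ℕ → Set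
Tied p q = (Handed p × Handed q × owner p ≡ owner q)
  ⊎ (Same (base p) (bound p) (base q) (bound q)
     × (∀ t → Event (base p) (bound p) t → (since p ≤ t → since q ≤ t)
                                         × (since q ≤ t → since p ≤ t)))

-- Invariance of events, and the equivalence relation

infix 4 _≐_

_≐_ : (f g : ℕ → ℕ → Set) → Set
f ≐ g = ∀ x y → (f x y → g x y) × (g x y → f x y)

≐-sym : ∀ {f g} → f ≐ g → g ≐ f
≐-sym e x y = proj₂ (e x y) , proj₁ (e x y)

≐-trans : ∀ {f g h} → f ≐ g → g ≐ h → f ≐ h
≐-trans e e′ x y =
  (λ p → proj₁ (e′ x y) (proj₁ (e x y) p)) , (λ p → proj₂ (e x y) (proj₂ (e′ x y) p))

Same⇒≐ : ∀ {j t i u} → Same j t i u → In j t ≐ In i u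
Same⇒≐ {j} {t} {i} {u} (s , s′) x y = In-mono {j} {t} {i} {u} s , In-mono {i} {u} {j} {t} s′

≐⇒Same : ∀ {j t i u} → In j t ≐ In i u → Same j t i u
≐⇒Same e = (λ w w< h → proj₁ (e _ _) (w , w< , h , refl , refl)) ,
           (λ w w< h → proj₂ (e _ _) (w , w< , h , refl , refl))

Same⇒own≡ : ∀ {j t i u} → Same j t i u → own j t ≡ own i u
Same⇒own≡ {j} {t} {i} {u} s = cong π₁ (Same⇒size≡ {j} {t} {i} {u} s)

Same⇒widx≡ : ∀ {j t i u} → Same j t i u → widx j t ≡ widx i u
Same⇒widx≡ {j} {t} {i} {u} s = cong π₂ (Same⇒size≡ {j} {t} {i} {u} s)

module _ {i u k v} (s : Same i u k v) where

  Pass-resp : ∀ {j t} → Pass j i u t → Pass j k v t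
  Pass-resp {j} (r , r< , s′) = r , r< , Same-trans {j} {r} {i} {u} {k} {v} s′ s

  Sits-resp : ∀ {j t} → Sits j i u t → Sits j k v t
  Sits-resp {j} (p , f) = Pass-resp {j} p ,
    λ r r< vis → Sub-trans {j} {r} {i} {u} {k} {v} (f r r< vis) (proj₁ s)

  Met-resp : ∀ {j e t} → Met j e i u t → Met j e k v t
  Met-resp {j} (p , w , w< , h , s′ , st) = Pass-resp {j} p , w , w< , h ,
    Same-trans {base (val w)} {bound (val w)} {i} {u} {k} {v} s′ s , st

EventFor-resp : ∀ {i u k v} → Same i u k v → ∀ {j e t} → EventFor j e i u t → EventFor j e k v t
EventFor-resp s {j} (inj₁ p)       = inj₁ (Sits-resp s {j} p)
EventFor-resp {i} {u} {k} {v} s {j} {e} (inj₂ (p , f)) = inj₂ (Met-resp s {j} {e} p ,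
  λ t′ t′<t p′ → f t′ t′<t (Met-resp (Same-sym {i} {u} {k} {v} s) {j} {e} p′))

-- `own` and `widx` are read off the size, so they depend on the graph of E(i,u) only, like all
-- other ingredients of an event.
Event-resp : ∀ {i u k v} → Same i u k v → ∀ {t} → Event i u t → Event k v t
Event-resp {i} {u} {k} {v} s {t} ev =
  subst₂ (λ j e → EventFor j e k v t) (Same⇒own≡ {i} {u} {k} {v} s) (Same⇒widx≡ {i} {u} {k} {v} s)
    (EventFor-resp {i} {u} {k} {v} s ev)

-- Each kind of event requires E(i,u) to agree with a part of its owner; equal size then makes this
-- part a visited one.
Event⇒Visited : ∀ {i u t} → Event i u t →
                ∃[ v ] (Visited (own i u) v × Same (own i u) v i u)
Event⇒Visited {i} {u} {t} ev = let v , _ , s = pass ev in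
  v , Same⇒own≡ {own i u} {v} {i} {u} s , s
  where
  pass : Event i u t → Pass (own i u) i u t
  pass (inj₁ (p , _))       = p
  pass (inj₂ ((p , _) , _)) = p

-- The old values are not lost in the union, because E(i,u) is itself among the parts visited by its
-- owner.
Handed⇒Ψ≐ : ∀ {i u s} → HandedAt i u s → ΨAt i u s ≐ Followed (own i u)
Handed⇒Ψ≐ {i} {u} {s} h@(t , _ , ev) x y = to , λ f → inj₂ (h , f)
  where
  to : ΨAt i u s x y → Followed (own i u) x y
  to (inj₁ p)       = let v , vis , s = Event⇒Visited {i} {u} {t} ev in
    v , vis , proj₂ (Same⇒≐ {own i u} {v} {i} {u} s x y) p
  to (inj₂ (_ , f)) = f

¬Handed⇒Ψ≐ : ∀ {i u s} → ¬ HandedAt i u s → ΨAt i u s ≐ In i u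
¬Handed⇒Ψ≐ {i} {u} {s} ¬h x y = to , inj₁
  where
  to : ΨAt i u s x y → In i u x y
  to (inj₁ p)       = p
  to (inj₂ (h , _)) = contradiction h ¬h

Followed⇒Total : ∀ {j x y} → Followed j x y → Total j x y
Followed⇒Total {j} (v , _ , p) = In⇒Total {j} {v} p

Ψ-functional : ∀ p {x y z} → Ψ p x y → Ψ p x z → y ≡ z
Ψ-functional p {x} f g with f | g
... | inj₁ a       | inj₁ b = Total-functional {base p}
    (In⇒Total {base p} {bound p} a) (In⇒Total {base p} {bound p} b)
... | inj₁ _       | inj₂ (h , _) = followed h f g
  where
  followed : Handed p → ∀ {y z} → Ψ p x y → Ψ p x z → y ≡ z
  followed h a b = Total-functional {owner p}
    (Followed⇒Total {owner p} (proj₁ (Handed⇒Ψ≐ {base p} {bound p} {since p} h _ _) a))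
    (Followed⇒Total {owner p} (proj₁ (Handed⇒Ψ≐ {base p} {bound p} {since p} h _ _) b))
... | inj₂ (h , _) | _ = Total-functional {owner p}
    (Followed⇒Total {owner p} (proj₁ (Handed⇒Ψ≐ {base p} {bound p} {since p} h _ _) f))
    (Followed⇒Total {owner p} (proj₁ (Handed⇒Ψ≐ {base p} {bound p} {since p} h _ _) g))

Tied-refl : ∀ p → Tied p p
Tied-refl p = inj₂ (Same-refl {base p} {bound p} , λ _ _ → (λ le → le) , (λ le → le))

Tied-sym : ∀ {p q} → Tied p q → Tied q p
Tied-sym (inj₁ (a , b , e)) = inj₁ (b , a , sym e)
Tied-sym {p} {q} (inj₂ (s , f)) = inj₂ (s′ , λ t ev →
  let a , b = f t (Event-resp {base q} {bound q} {base p} {bound p} s′ ev) in b , a)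
  where
  s′ : Same (base q) (bound q) (base p) (bound p)
  s′ = Same-sym {base p} {bound p} {base q} {bound q} s

Tied-Handed : ∀ {p q} → Same (base p) (bound p) (base q) (bound q) →
  (∀ t → Event (base p) (bound p) t → (since p ≤ t → since q ≤ t) × (since q ≤ t → since p ≤ t)) →
  Handed p → Handed q × owner p ≡ owner q
Tied-Handed {p} {q} s f (t , le , ev) =
  (t , proj₁ (f t ev) le , Event-resp {base p} {bound p} {base q} {bound q} s ev) ,
  Same⇒own≡ {base p} {bound p} {base q} {bound q} s

Tied-trans : ∀ {p q r} → Tied p q → Tied q r → Tied p r
Tied-trans (inj₁ (a , b , e)) (inj₁ (_ , c , e′)) = inj₁ (a , c , trans e e′)
Tied-trans {p} {q} {r} (inj₁ (a , b , e)) (inj₂ (s , f)) =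
  let c , e′ = Tied-Handed {q} {r} s f b in inj₁ (a , c , trans e e′)
Tied-trans {p} {q} {r} x@(inj₂ _) (inj₁ (b , c , e)) with Tied-sym {p} {q} x
... | inj₁ (_ , a , e′) = inj₁ (a , c , trans (sym e′) e)
... | inj₂ (s , f) = let a , e′ = Tied-Handed {q} {p} s f b in inj₁ (a , c , trans (sym e′) e)
Tied-trans {p} {q} {r} (inj₂ (s , f)) (inj₂ (s′ , f′)) = inj₂
  ( Same-trans {base p} {bound p} {base q} {bound q} {base r} {bound r} s s′
  , λ t ev → let a , b = f t ev
                 c , d = f′ t (Event-resp {base p} {bound p} {base q} {bound q} s ev)
             in (λ le → c (a le)) , (λ le → b (d le)))

index : ℕ → ℕ → ℕ → ℕ
index i u s = pr i (pr u s)

Ψ-index : ∀ i u s → Ψ (index i u s) ≡ ΨAt i u s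
Ψ-index i u s rewrite π₁-pr i (pr u s) | π₂-pr i (pr u s) | π₁-pr u s | π₂-pr u s = refl

-- Tied indices are equivalent; indices of a finite function are tied

module _ (em : ExcludedMiddle 0ℓ) where

  -- The second clause of `Tied` leaves open whether both indices or neither are handed over;
  -- excluded middle separates the two cases.
  Tied⇒≐ : ∀ {p q} → Tied p q → Ψ p ≐ Ψ q
  Tied⇒≐ {p} {q} (inj₁ (hp , hq , e)) =
    ≐-trans (Handed⇒Ψ≐ {base p} {bound p} {since p} hp)
      (≐-sym (subst (λ j → Ψ q ≐ Followed j) (sym e) (Handed⇒Ψ≐ {base q} {bound q} {since q} hq)))
  Tied⇒≐ {p} {q} r@(inj₂ (s , f)) with em {Handed p}
  ... | yes hp = let hq , e = Tied-Handed {p} {q} s f hp in Tied⇒≐ {p} {q} (inj₁ (hp , hq , e))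
  ... | no ¬hp =
    ≐-trans (¬Handed⇒Ψ≐ {base p} {bound p} {since p} ¬hp)
      (≐-trans (Same⇒≐ {base p} {bound p} {base q} {bound q} s)
        (≐-sym (¬Handed⇒Ψ≐ {base q} {bound q} {since q} ¬hq)))
    where
    ¬hq : ¬ Handed q
    ¬hq (t , le , ev) = ¬hp (t ,
      proj₂ (f t (Event-resp {base q} {bound q} {base p} {bound p}
        (Same-sym {base p} {bound p} {base q} {bound q} s) ev)) le ,
      Event-resp {base q} {bound q} {base p} {bound p}
        (Same-sym {base p} {bound p} {base q} {bound q} s) ev)

  -- The visited parts form a chain, so finitely many values lie in a single one of them.
  Followed-cover : ∀ {j v₀ i} → Visited j v₀ → ∀ n →
    (∀ w → w < n → Hit i w → Followed j (arg w) (val w)) → ∃[ v ] (Visited j v × Sub i n j v)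
  Followed-cover {v₀ = v₀} vis₀ zero    f = v₀ , vis₀ , λ _ ()
  Followed-cover {j} {v₀} {i} vis₀ (suc n) f
    with v , vis , s ← Followed-cover {j} {v₀} {i} vis₀ n (λ w w<n → f w (m<n⇒m<1+n w<n))
       | Hit? i n
  ... | no ¬h = v , vis , λ w w<1+n h → s w
    (≤∧≢⇒< (≤-pred w<1+n) λ { refl → ¬h h }) h
  ... | yes h with v′ , vis′ , p ← f n ≤-refl h | ≤-total v v′
  ...   | inj₁ v≤v′ = v′ , vis′ , sub
    where
    sub : Sub i (suc n) j v′
    sub w w<1+n h with m≤n⇒m<n∨m≡n (≤-pred w<1+n)
    ... | inj₁ w<n  = In-mono {j} {v} {j} {v′} (≤⇒Sub {j} v≤v′) (s w w<n h)
    ... | inj₂ refl = p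
  ...   | inj₂ v′≤v = v , vis , sub
    where
    sub : Sub i (suc n) j v
    sub w w<1+n h with m≤n⇒m<n∨m≡n (≤-pred w<1+n)
    ... | inj₁ w<n  = s w w<n h
    ... | inj₂ refl = In-mono {j} {v′} {j} {v} (≤⇒Sub {j} v′≤v) p

  Followed≐In⇒Visited : ∀ {j v₀ i u} → Visited j v₀ → Followed j ≐ In i u →
                        ∃[ v ] (Visited j v × Same j v i u)
  Followed≐In⇒Visited {j} {v₀} {i} {u} vis₀ e =
    let v , vis , s = Followed-cover {j} {v₀} {i} vis₀ u
          (λ w w<u h → proj₂ (e _ _) (w , w<u , h , refl , refl))
    in v , vis , (λ w w<v h → proj₁ (e _ _) (v , vis , w , w<v , h , refl , refl)) , s

  Handed-finite : ∀ {p i u} → Handed p → Ψ p ≐ In i u →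
                  ∃[ v ] (Visited (owner p) v × Same (owner p) v i u)
  Handed-finite {p} {i} {u} h@(t , _ , ev) e =
    let v₀ , vis₀ , _ = Event⇒Visited {base p} {bound p} {t} ev
    in Followed≐In⇒Visited {owner p} {v₀} {i} {u} vis₀
         (≐-trans (≐-sym (Handed⇒Ψ≐ {base p} {bound p} {since p} h)) e)

  Handed-finite-own : ∀ {p i u} → Handed p → Ψ p ≐ In i u → owner p ≡ own i u
  Handed-finite-own {p} {i} {u} h e = let v , vis , s = Handed-finite {p} {i} {u} h e in
    trans (sym vis) (Same⇒own≡ {owner p} {v} {i} {u} s)

  ¬Handed-Same : ∀ {p i u} → ¬ Handed p → Ψ p ≐ In i u → Same (base p) (bound p) i u
  ¬Handed-Same {p} {i} {u} ¬h e = ≐⇒Same {base p} {bound p} {i} {u}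
    (≐-trans (≐-sym (¬Handed⇒Ψ≐ {base p} {bound p} {since p} ¬h)) e)

  -- The owner of p visits E(i,u) and nothing beyond it, hence sits there at every later stage. If q
  -- starts from this same function, it is handed over as soon as the stage reaches `since q`.
  Handed-resp-finite : ∀ {p q i u} → Ψ p ≐ In i u → Ψ q ≐ In i u → Handed p → Handed q
  Handed-resp-finite {p} {q} {i} {u} ep eq hp with em {Handed q}
  ... | yes hq = hq
  ... | no ¬hq = t , m≤n⊔m v (since q) , inj₁
    (subst (λ j → Sits j (base q) (bound q) t) j≡ (pass , last))
    where
    j = owner p
    visited : ∃[ v ] (Visited j v × Same j v i u)
    visited = Handed-finite {p} {i} {u} hp ep
    v = proj₁ visited
    t = v ⊔ since q
    q≐ : Same i u (base q) (bound q)
    q≐ = Same-sym {base q} {bound q} {i} {u} (¬Handed-Same {q} {i} {u} ¬hq eq)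
    same : Same j v (base q) (bound q)
    same = Same-trans {j} {v} {i} {u} {base q} {bound q} (proj₂ (proj₂ visited)) q≐
    j≡ : j ≡ owner q
    j≡ = trans (sym (proj₁ (proj₂ visited))) (Same⇒own≡ {j} {v} {base q} {bound q} same)
    pass : Pass j (base q) (bound q) t
    pass = v , s≤s (m≤m⊔n v (since q)) , same
    last : ∀ r → r < suc t → Visited j r → Sub j r (base q) (bound q)
    last r _ vis w w<r h = In-mono {i} {u} {base q} {bound q} (proj₁ q≐)
      (proj₁ (ep _ _) (proj₂ (Handed⇒Ψ≐ {base p} {bound p} {since p} hp _ _)
        (r , vis , w , w<r , h , refl , refl)))

  -- Either both are handed over, and both owners are read off the size of E(i,u), or neither is,
  -- and both start from this function.
  finite⇒Tied : ∀ {p q i u} → Ψ p ≐ In i u → Ψ q ≐ In i u → Tied p q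
  finite⇒Tied {p} {q} {i} {u} ep eq with em {Handed p}
  ... | yes hp = inj₁ (hp , hq , trans (Handed-finite-own {p} {i} {u} hp ep)
                                       (sym (Handed-finite-own {q} {i} {u} hq eq)))
    where
    hq : Handed q
    hq = Handed-resp-finite {p} {q} {i} {u} ep eq hp
  ... | no ¬hp = inj₂
    ( s
    , λ t ev → (λ le → contradiction (t , le , ev) ¬hp)
             , (λ le → contradiction
                 (t , le , Event-resp {base p} {bound p} {base q} {bound q} s ev) ¬hq))
    where
    ¬hq : ¬ Handed q
    ¬hq hq = ¬hp (Handed-resp-finite {q} {p} {i} {u} eq ep hq)
    s : Same (base p) (bound p) (base q) (bound q)
    s = Same-trans {base p} {bound p} {i} {u} {base q} {bound q} (¬Handed-Same {p} {i} {u} ¬hp ep)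
      (Same-sym {base q} {bound q} {i} {u} (¬Handed-Same {q} {i} {u} ¬hq eq))

  -- Every partial computable function has an index

  size-unbounded : ∀ {j} → ¬ Finite j → ∀ n → ∃[ t ] n ≤ size j t
  size-unbounded         ¬fin zero    = 0 , z≤n
  size-unbounded {j} ¬fin (suc n)
    with t , n≤ ← size-unbounded {j} ¬fin n
       | em {∃[ w ] (t ≤ w × Hit j w)}
  ... | no ¬w = contradiction (t , λ w h → ≰⇒> λ t≤w → ¬w (w , t≤w , h)) ¬fin
  ... | yes (w , t≤w , h) = suc w , (begin
    suc n                       ≤⟨ s≤s (≤-trans n≤ (cnt-mono (Hit? j) t≤w)) ⟩
    suc (size j w)              ≡⟨ +-comm 1 (size j w) ⟩
    size j w + 1                ≡⟨ cong (size j w +_) (sym (ind≡1 (Hit? j w) h)) ⟩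
    size j w + ind (Hit? j w)   ∎)
    where open ≤-Reasoning

  size-hits : ∀ {j} → ¬ Finite j → ∀ n → ∃[ v ] size j v ≡ n
  size-hits {j} ¬fin n = let t , n≤ = size-unbounded {j} ¬fin n in size-reaches j n t n≤

  -- The part of size `pr j w` is visited, and its stage is at least its size, hence at least w.
  visited-beyond : ∀ {j} → ¬ Finite j → ∀ w → ∃[ v ] (Visited j v × w ≤ v)
  visited-beyond {j} ¬fin w = let v , e = size-hits {j} ¬fin (pr j w) in
    v , trans (cong π₁ e) (π₁-pr j w) ,
    ≤-trans (≤pr j w) (≤-trans (≤-reflexive (sym e)) (cnt≤ (Hit? j) v))

  Followed≐Total : ∀ {j} → ¬ Finite j → Followed j ≐ Total j
  Followed≐Total {j} ¬fin x y = Followed⇒Total {j} , λ (w , h) →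
    let v , vis , w<v = visited-beyond {j} ¬fin (suc w) in v , vis , w , w<v , h

  -- At stage v itself, no part of j seen so far exceeds E(j,v).
  Visited⇒Handed : ∀ {j v} → Visited j v → HandedAt j v 0
  Visited⇒Handed {j} {v} vis = v , z≤n , inj₁ (subst (λ k → Sits k j v v) (sym vis)
    ((v , ≤-refl , Same-refl {j} {v}) , λ r r< _ → ≤⇒Sub {j} (≤-pred r<)))

  Visited⇒Ψ≐Total : ∀ {j v} → ¬ Finite j → Visited j v → ΨAt j v 0 ≐ Total j
  Visited⇒Ψ≐Total {j} {v} ¬fin vis = ≐-trans
    (Handed⇒Ψ≐ {j} {v} {0} (Visited⇒Handed {j} {v} vis))
    (subst (λ k → Followed k ≐ Total j) (sym vis) (Followed≐Total {j} ¬fin))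

  -- If the owner visits nothing outside E(i,u), being handed over adds no values. Otherwise the
  -- events for E(i,u) come to an end, and a large `since` escapes them all.
  finite-indexed : ∀ i u → ∃[ s ] (ΨAt i u s ≐ In i u)
  finite-indexed i u with em {∃[ v ] (Visited (own i u) v × ¬ Sub (own i u) v i u)}
  ... | no ¬left = 0 , λ x y → to x y , inj₁
    where
    to : ∀ x y → ΨAt i u 0 x y → In i u x y
    to x y (inj₁ p) = p
    to x y (inj₂ (_ , v , vis , p)) with em {Sub (own i u) v i u}
    ... | yes s = In-mono {own i u} {v} {i} {u} s p
    ... | no ¬s = contradiction (v , vis , ¬s) ¬left
  ... | yes (v , vis , ¬s)
    with em {∃[ t ] FirstMet (own i u) (widx i u) i u t}
  ...   | no ¬first = v , ¬Handed⇒Ψ≐ {i} {u} {v} λ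
    { (t , v≤t , inj₁ (_ , last)) → ¬s (last v (s≤s v≤t) vis)
    ; (t , v≤t , inj₂ m)          → ¬first (t , m) }
  -- From stage v on the owner no longer sits at E(i,u), and the first meeting is over after `t₁`.
  ...   | yes (t₁ , m₁ , f₁) = v ⊔ suc t₁ , ¬Handed⇒Ψ≐ {i} {u} {v ⊔ suc t₁} λ
    { (t , le , inj₁ (_ , last)) → ¬s (last v (s≤s (≤-trans (m≤m⊔n v (suc t₁)) le)) vis)
    ; (t , le , inj₂ (m , f))    → f t₁ (≤-trans (m≤n⊔m v (suc t₁)) le) m₁ }

  finite-complete : ∀ i u → ∃[ p ] (Ψ p ≐ In i u)
  finite-complete i u = let s , e = finite-indexed i u in
    index i u s , subst (_≐ In i u) (sym (Ψ-index i u s)) e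

  Ψ-complete : ∀ j → ∃[ p ] (Ψ p ≐ Total j)
  Ψ-complete j with em {Finite j}
  ... | yes (T , below) = let p , e = finite-complete j T in p , ≐-trans e λ x y →
    In⇒Total {j} {T} , λ (w , h , eqs) → w , below w h , h , eqs
  ... | no ¬fin = let v , vis , _ = visited-beyond {j} ¬fin 0 in
    index j v 0 , subst (_≐ Total j) (sym (Ψ-index j v 0)) (Visited⇒Ψ≐Total {j} {v} ¬fin vis)

  -- Either some visited part already contains all hits of j, or the visited stages are bounded and
  -- the last one gives the union.
  Followed-finite : ∀ {j v₀} → Finite j → Visited j v₀ → ∃[ v ] (Followed j ≐ In j v)
  Followed-finite {j} {v₀} (T , below) vis₀ with em {∃[ v ] (Visited j v × T ≤ v)}
  ... | yes (v , vis , T≤v) = v , λ x y →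
    (λ f → let w , h , eqs = Followed⇒Total {j} f in w , <-≤-trans (below w h) T≤v , h , eqs) ,
    λ p → v , vis , p
  ... | no ¬v = let v , vis , max = greatest T (λ v vis T≤v → ¬v (v , vis , T≤v)) in
    v , λ x y → (λ (v′ , vis′ , p) → In-mono {j} {v′} {j} {v} (≤⇒Sub {j} (max v′ vis′)) p) ,
                λ p → v , vis , p
    where
    greatest : ∀ T → (∀ v → Visited j v → ¬ T ≤ v) →
               ∃[ v ] (Visited j v × (∀ v′ → Visited j v′ → v′ ≤ v))
    greatest zero    none = contradiction z≤n (none v₀ vis₀)
    greatest (suc T) none with em {Visited j T}
    ... | yes vis = T , vis , λ v′ vis′ → ≤-pred (≰⇒> (none v′ vis′))
    ... | no ¬vis = greatest T λ v vis T≤v →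
      none v vis (≤∧≢⇒< T≤v λ { refl → ¬vis vis })

  -- Translations meet every class

  module _ (τ : ℕ → ℕ) (e : ℕ) (enum : ∀ k → Total e k (τ k))
           (cover : ∀ p → ∃[ k ] (Ψ (τ k) ≐ Ψ p)) where

    val≡τ : ∀ {w} → Hit e w → val w ≡ τ (arg w)
    val≡τ {w} h = Total-functional {e} (w , h , refl , refl) (enum (arg w))

    -- The size `pr j e` makes j the owner of E(j,v) and e the function watched for it. As `τ k` is
    -- such a value, a first meeting takes place; the value handed over then may be another one with
    -- the same finite part.
    caught : ∀ {j v} k → size j v ≡ pr j e → ¬ Handed (τ k) → Ψ (τ k) ≐ In j v →
             ∃[ k′ ] (Handed (τ k′) × owner (τ k′) ≡ j)
    caught {j} {v} k n≡ ¬hq eq = arg w , subst Handed (val≡τ h) handed ,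
      subst (λ q′ → owner q′ ≡ j) (val≡τ h)
        (trans (Same⇒own≡ {base (val w)} {bound (val w)} {i} {u} s) own≡)
      where
      q i u : ℕ
      q = τ k
      i = base q
      u = bound q
      q-same : Same i u j v
      q-same = ¬Handed-Same {q} {j} {v} ¬hq eq
      own≡ : own i u ≡ j
      own≡ = trans (Same⇒own≡ {i} {u} {j} {v} q-same) (trans (cong π₁ n≡) (π₁-pr j e))
      widx≡ : widx i u ≡ e
      widx≡ = trans (Same⇒widx≡ {i} {u} {j} {v} q-same) (trans (cong π₂ n≡) (π₂-pr j e))
      met : ∃[ t ] Met j e i u t
      met = let w , h , _ , w≡ = enum k in
        -- Late enough for E(j,v) to have appeared, for the hit w to be found, and for `since q` to
        -- be reached.
        v + (suc w + since q) ,
        (v , s≤s (m≤m+n v _) , Same-sym {i} {u} {j} {v} q-same) ,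
        w , ≤-trans (m≤m+n (suc w) (since q)) (m≤n+m _ v) , h ,
        subst (λ q′ → Same (base q′) (bound q′) i u) (sym w≡) (Same-refl {i} {u}) ,
        ≤-trans (≤-reflexive (cong since w≡))
          (≤-trans (m≤n+m (since q) (suc w)) (m≤n+m (suc w + since q) v))
      first : ∃[ t ] FirstMet j e i u t
      first = least (λ _ → em) (proj₁ met) (proj₂ met)
      t w : ℕ
      t = proj₁ first
      w = proj₁ (proj₂ (proj₁ (proj₂ first)))
      h : Hit e w
      h = proj₁ (proj₂ (proj₂ (proj₂ (proj₁ (proj₂ first)))))
      s : Same (base (val w)) (bound (val w)) i u
      s = proj₁ (proj₂ (proj₂ (proj₂ (proj₂ (proj₁ (proj₂ first))))))
      event : Event i u t
      event = subst₂ (λ j e → EventFor j e i u t) (sym own≡) (sym widx≡) (inj₂ (proj₂ first))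
      handed : Handed (val w)
      handed = t , proj₂ (proj₂ (proj₂ (proj₂ (proj₂ (proj₁ (proj₂ first)))))) ,
        Event-resp {i} {u} {base (val w)} {bound (val w)}
          (Same-sym {base (val w)} {bound (val w)} {i} {u} s) event

    meets-finite : ∀ {p i u} → Ψ p ≐ In i u → ∃[ k ] Tied p (τ k)
    meets-finite {p} {i} {u} eq = let k , eq′ = cover p in
      k , finite⇒Tied {p} {τ k} {i} {u} eq (≐-trans eq′ eq)

    meets-infinite : ∀ {p} → Handed p → ¬ Finite (owner p) → ∃[ k ] Tied p (τ k)
    meets-infinite {p} hp ¬fin
      -- An infinite owner has a part of exactly this size, for which the values of `τ` are watched.
      with v , n≡ ← size-hits {owner p} ¬fin (pr (owner p) e)
      with r , r≐ ← finite-complete (owner p) v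
      with k , k≐ ← cover r
      with em {Handed (τ k)}
    -- The owner of a handed-over index of a finite function is read off the size of that function,
    -- here `owner p`.
    ... | yes hq = k , inj₁ (hp , hq , sym (trans
      (Handed-finite-own {τ k} {owner p} {v} hq (≐-trans k≐ r≐))
      (trans (cong π₁ n≡) (π₁-pr (owner p) e))))
    ... | no ¬hq = let k′ , h , o = caught {owner p} {v} k n≡ ¬hq (≐-trans k≐ r≐) in
      k′ , inj₁ (hp , h , sym o)

    meets : ∀ p → ∃[ k ] Tied p (τ k)
    meets p with em {Handed p}
    ... | no ¬h = meets-finite {p} {base p} {bound p} (¬Handed⇒Ψ≐ {base p} {bound p} {since p} ¬h)
    ... | yes h@(t , _ , ev) with em {Finite (owner p)}
    ...   | no ¬fin = meets-infinite {p} h ¬fin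
    ...   | yes fin =
      let v₀ , vis , _ = Event⇒Visited {base p} {bound p} {t} ev
          v , eq = Followed-finite {owner p} {v₀} fin vis
      in meets-finite {p} {owner p} {v} (≐-trans (Handed⇒Ψ≐ {base p} {bound p} {since p} h) eq)

-- Computability of the construction

-- The clauses and the order of the variables follow the definitions of the construction, so that
-- `Holds` unfolds to them.
inᴿ subᴿ sameᴿ passᴿ sitsᴿ caughtᴿ : DecRel 4
metᴿ firstMetᴿ eventForᴿ : DecRel 5
visitedᴿ handsᴿ : DecRel 2
eventᴿ : DecRel 3

sizeᶠ ownᶠ widxᶠ : ∀ {n} → Fun n → Fun n → Fun n
sizeᶠ j t = count x1 (hit x1 x0) ⟨ j ∷ t ∷ [] ⟩ᶠ
ownᶠ j t  = π₁ᶠ (sizeᶠ j t)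
widxᶠ j t = π₂ᶠ (sizeᶠ j t)

baseᶠ boundᶠ sinceᶠ ownerᶠ : ∀ {n} → Fun n → Fun n
baseᶠ p  = π₁ᶠ p
boundᶠ p = π₁ᶠ (π₂ᶠ p)
sinceᶠ p = π₂ᶠ (π₂ᶠ p)
ownerᶠ p = ownᶠ (baseᶠ p) (boundᶠ p)

inᴿ = ex< x1 (hit x1 x0 ∧ᴿ argᶠ x0 ≡ᴿ x3 ∧ᴿ valᶠ x0 ≡ᴿ x4)
subᴿ = all< x1 (hit x1 x0 ⇒ᴿ inᴿ ⟨ x3 ∷ x4 ∷ argᶠ x0 ∷ valᶠ x0 ∷ [] ⟩)
sameᴿ = subᴿ ∧ᴿ subᴿ ⟨ x2 ∷ x3 ∷ x0 ∷ x1 ∷ [] ⟩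
visitedᴿ = ownᶠ x0 x1 ≡ᴿ x0
passᴿ = ex< (sucᶠ x3) (sameᴿ ⟨ x1 ∷ x0 ∷ x2 ∷ x3 ∷ [] ⟩)
sitsᴿ = passᴿ ∧ᴿ
  all< (sucᶠ x3) (visitedᴿ ⟨ x1 ∷ x0 ∷ [] ⟩ ⇒ᴿ subᴿ ⟨ x1 ∷ x0 ∷ x2 ∷ x3 ∷ [] ⟩)
caughtᴿ = ex< x3 (hit x1 x0
  ∧ᴿ sameᴿ ⟨ baseᶠ (valᶠ x0) ∷ boundᶠ (valᶠ x0) ∷ x2 ∷ x3 ∷ [] ⟩
  ∧ᴿ sinceᶠ (valᶠ x0) ≤ᴿ x4)
metᴿ = passᴿ ⟨ x0 ∷ x2 ∷ x3 ∷ x4 ∷ [] ⟩ ∧ᴿ caughtᴿ ⟨ x1 ∷ x2 ∷ x3 ∷ x4 ∷ [] ⟩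
firstMetᴿ = metᴿ ∧ᴿ all< x4 (¬ᴿ metᴿ ⟨ x1 ∷ x2 ∷ x3 ∷ x4 ∷ x0 ∷ [] ⟩)
eventForᴿ = sitsᴿ ⟨ x0 ∷ x2 ∷ x3 ∷ x4 ∷ [] ⟩ ∨ᴿ firstMetᴿ
eventᴿ = eventForᴿ ⟨ ownᶠ x0 x1 ∷ widxᶠ x0 x1 ∷ x0 ∷ x1 ∷ x2 ∷ [] ⟩
handsᴿ = sinceᶠ x0 ≤ᴿ x1 ∧ᴿ eventᴿ ⟨ baseᶠ x0 ∷ boundᶠ x0 ∷ x1 ∷ [] ⟩

-- The witness codes the value y, the stage t of an event and the stage v of a visited part.
Σ₁Ψ : DecRel 3
Σ₁Ψ = inᴿ ⟨ baseᶠ p ∷ boundᶠ p ∷ x ∷ y ∷ [] ⟩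
  ∨ᴿ (handsᴿ ⟨ p ∷ t ∷ [] ⟩
    ∧ᴿ (visitedᴿ ⟨ ownerᶠ p ∷ v ∷ [] ⟩ ∧ᴿ inᴿ ⟨ ownerᶠ p ∷ v ∷ x ∷ y ∷ [] ⟩))
  where
  p x y t v : Fun 3
  p = x1
  x = x2
  y = π₁ᶠ x0
  t = π₁ᶠ (π₂ᶠ x0)
  v = π₂ᶠ (π₂ᶠ x0)

-- The witness codes two stages of events. The quantifier over all stages is cut off at
-- `since p + since q`, from where on both inequalities hold.
Σ₁Tied : DecRel 3
Σ₁Tied =
  (handsᴿ ⟨ p ∷ π₁ᶠ x0 ∷ [] ⟩ ∧ᴿ handsᴿ ⟨ q ∷ π₂ᶠ x0 ∷ [] ⟩ ∧ᴿ ownerᶠ p ≡ᴿ ownerᶠ q)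
  ∨ᴿ (sameᴿ ⟨ baseᶠ p ∷ boundᶠ p ∷ baseᶠ q ∷ boundᶠ q ∷ [] ⟩
    ∧ᴿ all< (sinceᶠ p +ᶠ sinceᶠ q) (eventᴿ ⟨ baseᶠ x2 ∷ boundᶠ x2 ∷ x0 ∷ [] ⟩
      ⇒ᴿ ((sinceᶠ x2 ≤ᴿ x0 ⇒ᴿ sinceᶠ x3 ≤ᴿ x0) ∧ᴿ (sinceᶠ x3 ≤ᴿ x0 ⇒ᴿ sinceᶠ x2 ≤ᴿ x0))))
  where
  p q : Fun 3
  p = x1
  q = x2

Ψ-graph : PartialFn 2
Ψ-graph = record
  { graph      = λ { (p ∷ x ∷ []) y → Ψ p x y }
  ; functional = λ { (p ∷ x ∷ []) → Ψ-functional p }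
  }

Ψ-computable : PartialComputable Ψ-graph
Ψ-computable = Σ₁⇒PartialComputable Ψ-graph Σ₁Ψ (π₁ᶠ x0) λ
  { (p ∷ x ∷ []) y → mk⇔ (to p x y) (from p x y) }
  where
  Witness : ℕ → ℕ → ℕ → ℕ → ℕ → Set
  Witness p x y t v = In (base p) (bound p) x y
    ⊎ ((since p ≤ t × Event (base p) (bound p) t) × (Visited (owner p) v × In (owner p) v x y))
  coded : ∀ p x y t v → Witness p x y t v →
          ∃[ s ] (Holds Σ₁Ψ (s ∷ p ∷ x ∷ []) × π₁ s ≡ y)
  coded p x y t v h = pr y (pr t v) , unpaired , π₁-pr y (pr t v)
    where
    unpaired : Holds Σ₁Ψ (pr y (pr t v) ∷ p ∷ x ∷ [])
    unpaired rewrite π₁-pr y (pr t v) | π₂-pr y (pr t v) | π₁-pr t v | π₂-pr t v = h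
  to : ∀ p x y → Ψ p x y → ∃[ s ] (Holds Σ₁Ψ (s ∷ p ∷ x ∷ []) × π₁ s ≡ y)
  -- The two stages are placeholders, as the value lies in the initial finite part.
  to p x y (inj₁ a)                        = coded p x y 0 0 (inj₁ a)
  to p x y (inj₂ ((t , h) , (v , vis , a))) = coded p x y t v (inj₂ (h , vis , a))
  from : ∀ p x y → ∃[ s ] (Holds Σ₁Ψ (s ∷ p ∷ x ∷ []) × π₁ s ≡ y) → Ψ p x y
  from p x y (s , inj₁ a , refl)             = inj₁ a
  from p x y (s , inj₂ (h , vis , a) , refl) = inj₂ ((_ , h) , (_ , vis , a))

Tied-graph : PartialFn 2
Tied-graph = record
  { graph      = λ { (p ∷ q ∷ []) y → Tied p q × y ≡ 0 }
  ; functional = λ { (p ∷ q ∷ []) (_ , e) (_ , e′) → trans e (sym e′) }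
  }

Tied-CE : CE Tied
Tied-CE = Tied-graph ,
  Σ₁⇒PartialComputable Tied-graph Σ₁Tied (lit 0)
    (λ { (p ∷ q ∷ []) y → mk⇔ (to p q y) (λ { (s , h , e) → from p q s h , sym e }) }) ,
  λ p q → mk⇔ (λ r → 0 , r , refl) (λ (_ , r , _) → r)
  where
  to : ∀ p q y → Tied p q × y ≡ 0 → ∃[ s ] (Holds Σ₁Tied (s ∷ p ∷ q ∷ []) × 0 ≡ y)
  to p q y (inj₂ (s , f) , e) = 0 , inj₂ (s , λ t _ → f t) , sym e
  to p q y (inj₁ ((t , h) , (t′ , h′) , o) , e) = pr t t′ , unpaired , sym e
    where
    unpaired : Holds Σ₁Tied (pr t t′ ∷ p ∷ q ∷ [])
    unpaired rewrite π₁-pr t t′ | π₂-pr t t′ = inj₁ (h , h′ , o)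
  from : ∀ p q s → Holds Σ₁Tied (s ∷ p ∷ q ∷ []) → Tied p q
  from p q s (inj₁ (h , h′ , o)) = inj₁ ((_ , h) , (_ , h′) , o)
  from p q s (inj₂ (same , f))   = inj₂ (same , λ t ev → decide t ev (t <? since p + since q))
    where
    decide : ∀ t → Event (base p) (bound p) t → Dec (t < since p + since q) →
             (since p ≤ t → since q ≤ t) × (since q ≤ t → since p ≤ t)
    decide t ev (yes t<) = f t t< ev
    decide t ev (no t≮)  =
      (λ _ → ≤-trans (m≤n+m (since q) (since p)) (≮⇒≥ t≮)) ,
      (λ _ → ≤-trans (m≤m+n (since p) (since q)) (≮⇒≥ t≮))

-- Enumeration of the unary partial computable functions

Total-⌜⌝ : ∀ (c : Code 2) a x y → Total (pr ⌜ c ⌝ a) x y ⇔ c [ a ∷ x ∷ [] ]⇓ y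
Total-⌜⌝ c a x y = mk⇔
  (λ { (w , h , refl , refl) → Hit-sound c a w h })
  (Hit-complete c a x y)

-- Every number j carries a parameter; a unary function enters the enumeration by ignoring it.
second-argument : Code 1 → Code 2
second-argument c = comp c (proj (suc zero) ∷ [])

Total-unary : ∀ (c : Code 1) x y → Total (pr ⌜ second-argument c ⌝ 0) x y ⇔ c [ x ∷ [] ]⇓ y
Total-unary c x y = mk⇔
  (λ h → unary (to h))
  (λ p → from (x ∷ [] , (refl , tt) , p))
  where
  open Equivalence (Total-⌜⌝ (second-argument c) 0 x y)
  unary : second-argument c [ 0 ∷ x ∷ [] ]⇓ y → c [ x ∷ [] ]⇓ y
  unary (_ ∷ [] , (refl , _) , p) = p

at-computable : ∀ {f} → PartialComputable f → ∀ p → PartialComputable (f at p)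
at-computable (c , spec) p = comp c (F.code (lit {1} p) ∷ proj zero ∷ []) , λ
  { (x ∷ []) y → mk⇔
    (λ h → p ∷ x ∷ [] , (F.computes (lit {1} p) (x ∷ []) , refl , tt) ,
           Equivalence.to (spec (p ∷ x ∷ []) y) h)
    λ { (a ∷ b ∷ [] , (ea , refl , _) , h) → Equivalence.from (spec (p ∷ x ∷ []) y)
      (subst (λ a → c [ a ∷ x ∷ [] ]⇓ y)
        (⇓-functional (F.code (lit {1} p)) (x ∷ []) ea (F.computes (lit {1} p) (x ∷ []))) h) } }

≈-sym : ∀ {n} {f g : PartialFn n} → f ≈ g → g ≈ f
≈-sym e xs y = mk⇔ (Equivalence.from (e xs y)) (Equivalence.to (e xs y))

≈-trans : ∀ {n} {f g h : PartialFn n} → f ≈ g → g ≈ h → f ≈ h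
≈-trans e e′ xs y = mk⇔
  (λ p → Equivalence.to (e′ xs y) (Equivalence.to (e xs y) p))
  (λ p → Equivalence.from (e xs y) (Equivalence.from (e′ xs y) p))

≐⇒≈ : ∀ {p q} → Ψ p ≐ Ψ q → Ψ-graph at p ≈ Ψ-graph at q
≐⇒≈ e (x ∷ []) y = mk⇔ (proj₁ (e x y)) (proj₂ (e x y))

≈⇒≐ : ∀ {p q} → Ψ-graph at p ≈ Ψ-graph at q → Ψ p ≐ Ψ q
≈⇒≐ e x y = Equivalence.to (e (x ∷ []) y) , Equivalence.from (e (x ∷ []) y)

Zero : ℕ → ℕ → Set
Zero x y = y ≡ 0

-- The eps, its ceer and the diagonal argument

module _ (em : ExcludedMiddle 0ℓ) where

  Ψ-complete-code : ∀ (c : Code 1) → ∃[ p ] (Ψ p ≐ λ x y → c [ x ∷ [] ]⇓ y)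
  Ψ-complete-code c = let p , e = Ψ-complete em (pr ⌜ second-argument c ⌝ 0) in
    p , ≐-trans e λ x y → Equivalence.to (Total-unary c x y) , Equivalence.from (Total-unary c x y)

  Ψ-eps : Eps
  Ψ-eps = record
    { fn         = Ψ-graph
    ; computable = Ψ-computable
    ; complete   = λ ζ (c , spec) → let p , e = Ψ-complete-code c in
        p , λ { (x ∷ []) y → mk⇔
          (λ h → Equivalence.from (spec (x ∷ []) y) (proj₁ (e x y) h))
          (λ h → proj₂ (e x y) (Equivalence.to (spec (x ∷ []) y) h)) }
    }

  Tied-isCeer : IsCeer Tied
  Tied-isCeer = record
    { isEquivalence = record
      { refl  = λ {p} → Tied-refl p
      ; sym   = λ {p} {q} → Tied-sym {p} {q}
      ; trans = λ {p} {q} {r} → Tied-trans {p} {q} {r}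
      }
    ; enumerable = Tied-CE
    }

  Tied⇒Equiv : Tied ⇒ Equiv Ψ-eps
  Tied⇒Equiv {p} {q} r = ≐⇒≈ {p} {q} (Tied⇒≐ em {p} {q} r)

  Tied-stronglyTies : ∀ t → IsTranslationInto t Ψ-eps → StronglyTies Tied t Ψ-eps
  Tied-stronglyTies t (θ , w) = record { sound = λ {p} {q} → Tied⇒Equiv {p} {q} ; meets = λ p →
    let k , r = meets em t (pr ⌜ second-argument c ⌝ 0) enum cover p in t k , (k , refl) , r }
    where
    c : Code 1
    c = proj₁ (Witnesses.computable w)
    enum : ∀ k → Total (pr ⌜ second-argument c ⌝ 0) k (t k)
    enum k = Equivalence.from (Total-unary c k (t k)) (proj₂ (Witnesses.computable w) k)
    cover : ∀ p → ∃[ k ] (Ψ (t k) ≐ Ψ p)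
    -- `θ` is complete, so it has a program for the function of p, and `t` carries it to an index of
    -- the same function.
    cover p = let k , e = complete θ (prog Ψ-eps p) (at-computable {Ψ-graph} Ψ-computable p) in
      k , ≈⇒≐ {t k} {p} (≈-trans {f = prog Ψ-eps (t k)} {prog θ k} {prog Ψ-eps p}
            (≈-sym {f = prog θ k} {prog Ψ-eps (t k)} (Witnesses.translates w k)) e)

  -- On input (n, x) the diagonal program returns 0 as long as no m ≤ x shows that
  -- f, with code cf, equates an index handed over to pr n n with p₀. If n is the
  -- number of this program itself, this is contradictory.
  module Diagonal (cf : Code 2) (p₀ : ℕ) (p₀-zero : Ψ p₀ ≐ Zero) where

    idx : ℕ → ℕ → ℕ
    idx n v = index (pr n n) v 0

    shows : DecRel 2
    shows = visitedᴿ ⟨ j ∷ v ∷ [] ⟩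
      ∧ᴿ (hit (prᶠ (lit ⌜ cf ⌝) (prᶠ j (prᶠ v (lit 0)))) w ∧ᴿ argᶠ w ≡ᴿ lit p₀)
      where
      j v w : Fun 2
      j = prᶠ x0 x0
      v = π₁ᶠ x1
      w = π₂ᶠ x1

    Shows : ℕ → ℕ → Set
    Shows n m = Holds shows (n ∷ m ∷ [])

    diagonal : PartialFn 2
    diagonal = record
      { graph      = λ { (n ∷ x ∷ []) y → (∀ m → m < suc x → ¬ Shows n m) × y ≡ 0 }
      ; functional = λ { (n ∷ x ∷ []) (_ , e) (_ , e′) → trans e (sym e′) }
      }

    diagonal-computable : PartialComputable diagonal
    diagonal-computable = Σ₁⇒PartialComputable diagonal
      (all< (sucᶠ x2) (¬ᴿ shows ⟨ x2 ∷ x0 ∷ [] ⟩)) (lit 0)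
      λ { (n ∷ x ∷ []) y → mk⇔ (λ (h , e) → 0 , h , sym e) (λ (_ , h , e) → h , sym e) }

    module _ (c₀ : Code 2) (diagonal≈c₀ : diagonal ≈ ⟦ c₀ ⟧) where

      -- The parameter of `j₀` is the number of the diagonal program itself, which yields the
      -- self-reference.
      n₀ j₀ : ℕ
      n₀ = ⌜ c₀ ⌝
      j₀ = pr n₀ n₀

      Total-j₀ : ∀ x y → Total j₀ x y ⇔ ((∀ m → m < suc x → ¬ Shows n₀ m) × y ≡ 0)
      Total-j₀ x y = mk⇔
        (λ h → Equivalence.from (diagonal≈c₀ (n₀ ∷ x ∷ []) y)
                 (Equivalence.to (Total-⌜⌝ c₀ n₀ x y) h))
        (λ h → Equivalence.from (Total-⌜⌝ c₀ n₀ x y)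
                 (Equivalence.to (diagonal≈c₀ (n₀ ∷ x ∷ []) y) h))

      shown⇒Visited×equated : ∀ m → Shows n₀ m →
        ∃[ v ] (Visited j₀ v × ∃[ y ] cf [ idx n₀ v ∷ p₀ ∷ [] ]⇓ y)
      shown⇒Visited×equated m (vis , h , e) = π₁ m , vis , val (π₂ m) ,
        subst (λ x → cf [ idx n₀ (π₁ m) ∷ x ∷ [] ]⇓ val (π₂ m)) e
          (Hit-sound cf (idx n₀ (π₁ m)) (π₂ m) h)

      Visited×equated⇒shown : ∀ v y → Visited j₀ v → cf [ idx n₀ v ∷ p₀ ∷ [] ]⇓ y →
                              ∃[ m ] Shows n₀ m
      Visited×equated⇒shown v y vis p with w , h , e , _ ← Hit-complete cf (idx n₀ v) p₀ y p =
        pr v w , unpaired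
        where
        unpaired : Shows n₀ (pr v w)
        unpaired rewrite π₁-pr v w | π₂-pr v w = vis , h , e

      contradictory : (∀ q → (Ψ q ≐ Ψ p₀) ⇔ (∃[ y ] cf [ q ∷ p₀ ∷ [] ]⇓ y)) → ⊥
      contradictory decides with em {∃[ m ] Shows n₀ m}
      -- The index shown is equated with `p₀`, so it computes zero; being handed over to `j₀`, it
      -- makes `j₀` defined at m, where the diagonal program is undefined because of m.
      ... | yes (m , s) = proj₁ (Equivalence.to (Total-j₀ m 0) total) m ≤-refl s
        where
        shown = shown⇒Visited×equated m s
        v = proj₁ shown
        vis : Visited j₀ v
        vis = proj₁ (proj₂ shown)
        zero-idx : ΨAt j₀ v 0 ≐ Zero
        zero-idx = subst (_≐ Zero) (Ψ-index j₀ v 0)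
          (≐-trans (Equivalence.from (decides (idx n₀ v)) (proj₂ (proj₂ shown))) p₀-zero)
        total : Total j₀ m 0
        total = Followed⇒Total {j₀} (subst (λ j → Followed j m 0) vis
          (proj₁ (Handed⇒Ψ≐ {j₀} {v} {0} (Visited⇒Handed em {j₀} {v} vis) m 0)
            (proj₂ (zero-idx m 0) refl)))
      -- Now `j₀` is the zero function and infinite, so the index of a visited part computes zero.
      -- It must then be equated with `p₀`, which is something to show.
      ... | no none = none (Visited×equated⇒shown v (proj₁ equated) vis (proj₂ equated))
        where
        total : Total j₀ ≐ Zero
        total x y = (λ h → proj₂ (Equivalence.to (Total-j₀ x y) h)) ,
          λ e → Equivalence.from (Total-j₀ x y) ((λ m _ s → none (m , s)) , e)
        ¬fin : ¬ Finite j₀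
        ¬fin (T , below) = let w , h , e , _ = proj₂ (total T 0) refl in
          -- A hit is at least as large as its argument, so the hit at argument T is not below T.
          <-irrefl refl (<-≤-trans (below w h) (≤-trans (≤-reflexive (sym e)) (π₁≤ w)))
        v : ℕ
        v = proj₁ (visited-beyond em {j₀} ¬fin 0)
        vis : Visited j₀ v
        vis = proj₁ (proj₂ (visited-beyond em {j₀} ¬fin 0))
        equated : ∃[ y ] cf [ idx n₀ v ∷ p₀ ∷ [] ]⇓ y
        equated = Equivalence.to (decides (idx n₀ v))
          (≐-trans (subst (_≐ Zero) (sym (Ψ-index j₀ v 0))
                     (≐-trans (Visited⇒Ψ≐Total em {j₀} {v} ¬fin vis) total))
                   (≐-sym p₀-zero))

  Equiv-¬CE : ¬ CE (Equiv Ψ-eps)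
  Equiv-¬CE (f , (cf , f≈cf) , spec) = let p₀ , p₀-zero = Ψ-complete-code zer in
    let open Diagonal cf p₀ p₀-zero
        c₀ , diagonal≈c₀ = diagonal-computable
    in contradictory c₀ diagonal≈c₀ λ q → mk⇔
      (λ e → let y , fy = Equivalence.to (spec q p₀) (≐⇒≈ {q} {p₀} e) in
             y , Equivalence.to (f≈cf (q ∷ p₀ ∷ []) y) fy)
      (λ (y , h) → ≈⇒≐ {q} {p₀} (Equivalence.from (spec q p₀)
                     (y , Equivalence.from (f≈cf (q ∷ p₀ ∷ []) y) h)))

theorem9 : ExcludedMiddle 0ℓ →
    Σ[ ψ ∈ Eps ] Σ[ R ∈ Rel ℕ 0ℓ ]
    ( IsCeer R
    × R ⇒ Equiv ψ
    × (∀ (t : ℕ → ℕ) → IsTranslationInto t ψ → StronglyTies R t ψ)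
    × ¬ CE (Equiv ψ) )
theorem9 em = Ψ-eps em , Tied , Tied-isCeer em ,
  (λ {p} {q} → Tied⇒Equiv em {p} {q}) , Tied-stronglyTies em , Equiv-¬CE em
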